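{- Let $\mathcal{L}$ be a computable relational language. Then the relation $\cong_{\mathcal{L}}^c$ of computable isomorphism on $X_\mathcal{L}$ is $\Pi^0_2$-graphable with diameter $2$.
   Context: A countable relational language $\mathcal{L}=\{R_0,R_1,\dots\}$ is computable if $i\mapsto \mathrm{arity}(R_i)$ is computable. $X_\mathcal{L}=\prod_i 2^{(\mathbb{N}^{\mathrm{arity}(R_i)})}$ is the space of $\mathcal{L}$-structures with universe $\mathbb{N}$ (computably isomorphic to $2^\mathbb{N}$). For $x,y\in X_\mathcal{L}$, $x\cong_\mathcal{L}^c y$ means there is a computable bijection $f:\mathbb{N}\to\mathbb{N}$ that is an $\mathcal{L}$-isomorphism from $x$ to $y$. For a pointclass $\Gamma$ (lightface arithmetical classes here), an equivalence relation $E$ on a space $X$ is $\Gamma$-graphable if there is a simple undirected graph $G\subseteq X\times X$ (irreflexive, symmetric) in $\Gamma$ such that $xEy$ iff $x$ and $y$ are connected by a finite path in $G$. The graph has diameter $k$ if $k$ is the least integer such that any two $G$-connected points are joined by a path of length at most $k$; $E$ is $\Gamma$-graphable with diameter $k$ if it has such a $\Gamma$ graphing of diameter $k$. -}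

module Defs where

open import Level using (0ℓ)
open import Data.Bool using (Bool; true; false; if_then_else_)
open import Data.Fin using (Fin; toℕ; fromℕ<)
open import Data.Maybe using (Maybe; just; nothing; maybe′)
open import Data.Nat using (ℕ; zero; suc; _+_; _≤_; _<_; _<?_)
open import Data.Product using (_×_; _,_; proj₁; proj₂; ∃-syntax)
open import Data.Vec using (Vec; []; _∷_; map)
open import Function.Bundles using (_⇔_)
open import Function.Definitions using (Bijective)
open import Relation.Binary.Core using (Rel)
open import Relation.Binary.Definitions using (Irreflexive; Symmetric)
open import Relation.Binary.PropositionalEquality using (_≡_)
open import Relation.Nullary using (yes; no)

-- Cantor's pairing bijection.  `unpair` walks along the antidiagonals,
-- (0,0), (1,0), (0,1), (2,0), (1,1), (0,2), ..., and inverts `⟨_,_⟩`.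

triangle : ℕ → ℕ
triangle zero    = zero
triangle (suc n) = suc n + triangle n

⟨_,_⟩ : ℕ → ℕ → ℕ
⟨ a , b ⟩ = triangle (a + b) + b

next : ℕ × ℕ → ℕ × ℕ
next (zero  , b) = suc b , zero
next (suc a , b) = a , suc b

unpair : ℕ → ℕ × ℕ
unpair zero    = zero , zero
unpair (suc n) = next (unpair n)

-- Every number codes a k-tuple and every k-tuple has a (non-unique) code.

untuple : ∀ k → ℕ → Vec ℕ k
untuple zero    n = []
untuple (suc k) n = proj₁ (unpair n) ∷ untuple k (proj₂ (unpair n))

Cantor : Set
Cantor = ℕ → Bool

_⊕_ : Cantor → Cantor → Cantor
(α ⊕ β) n with unpair n
... | zero  , m = α m
... | suc _ , m = β m

-- Kleene's partial recursive functions relative to an oracle in 2^ℕ,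
-- presented as unary functions; several arguments are passed by pairing.

data Code : Set where
  zero succ left right oracle : Code
  pair comp prec              : Code → Code → Code
  μ                           : Code → Code

PrimRec : (F G : ℕ → ℕ → Set) → ℕ → ℕ → ℕ → Set
PrimRec F G a zero    m = F a m
PrimRec F G a (suc n) m = ∃[ k ] PrimRec F G a n k × G ⟨ a , ⟨ n , k ⟩ ⟩ m

-- `α ⊢ c ∙ n ↓ m`: program c with oracle α halts on input n with output m.

_⊢_∙_↓_ : Cantor → Code → ℕ → ℕ → Set
α ⊢ zero     ∙ n ↓ m = m ≡ 0
α ⊢ succ     ∙ n ↓ m = m ≡ suc n
α ⊢ left     ∙ n ↓ m = m ≡ proj₁ (unpair n)
α ⊢ right    ∙ n ↓ m = m ≡ proj₂ (unpair n)
α ⊢ oracle   ∙ n ↓ m = m ≡ (if α n then 1 else 0)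
α ⊢ pair c d ∙ n ↓ m =
  ∃[ a ] ∃[ b ] (α ⊢ c ∙ n ↓ a) × (α ⊢ d ∙ n ↓ b) × m ≡ ⟨ a , b ⟩
α ⊢ comp c d ∙ n ↓ m = ∃[ k ] (α ⊢ d ∙ n ↓ k) × (α ⊢ c ∙ k ↓ m)
α ⊢ prec c d ∙ n ↓ m =
  PrimRec (α ⊢ c ∙_↓_) (α ⊢ d ∙_↓_) (proj₁ (unpair n)) (proj₂ (unpair n)) m
α ⊢ μ c      ∙ n ↓ m =
  (α ⊢ c ∙ ⟨ n , m ⟩ ↓ 0) ×
  (∀ k → k < m → ∃[ v ] (α ⊢ c ∙ ⟨ n , k ⟩ ↓ suc v))

-- Without oracle, i.e. with the constant oracle.

Computable : (ℕ → ℕ) → Set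
Computable f = ∃[ c ] (∀ n → (λ _ → false) ⊢ c ∙ n ↓ f n)

-- A countable language has finitely many symbols or one for each number.

data Size : Set where
  finite   : ℕ → Size
  infinite : Size

Symbol : Size → Set
Symbol (finite n) = Fin n
Symbol infinite   = ℕ

index : ∀ {s} → Symbol s → ℕ
index {finite n} i = toℕ i
index {infinite} i = i

symbol : ∀ s → ℕ → Maybe (Symbol s)
symbol (finite n) i with i <? n
... | yes i<n = just (fromℕ< i<n)
... | no  _   = nothing
symbol infinite   i = just i

record Language : Set where
  field
    size  : Size
    arity : Symbol size → ℕ

open Language public

ComputableLanguage : Language → Set
ComputableLanguage L =
  ∃[ a ] Computable a × (∀ (R : Symbol (size L)) → a (index R) ≡ arity L R)

Structure : Language → Set
Structure L = (R : Symbol (size L)) → Vec ℕ (arity L R) → Bool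

-- Equality of points of X_L; `≡` on functions would be too fine.

SameStructure : ∀ L → Rel (Structure L) 0ℓ
SameStructure L x y = ∀ R v → x R v ≡ y R v

IsIsomorphism : ∀ L → Structure L → Structure L → (ℕ → ℕ) → Set
IsIsomorphism L x y f = Bijective _≡_ _≡_ f × (∀ R v → x R v ≡ y R (map f v))

ComputablyIsomorphic : ∀ L → Rel (Structure L) 0ℓ
ComputablyIsomorphic L x y = ∃[ f ] Computable f × IsIsomorphism L x y f

-- A computable embedding of X_L in 2^ℕ: bit ⟨ i , w ⟩ tells whether R_i holds
-- of the tuple coded by w.  Tuples with several codes only repeat bits, and
-- bits of absent symbols are false; neither affects the lightface classes.

toCantor : ∀ L → Structure L → Cantor
toCantor L x n =
  maybe′ (λ R → x R (untuple (arity L R) (proj₂ (unpair n)))) false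
         (symbol (size L) (proj₁ (unpair n)))

-- Lightface Σ⁰₁ subsets of ℕ × X_L × X_L (semirecursive: the halting set of a
-- program that has its two points as oracle) and Π⁰₂ subsets of X_L × X_L.

IsΣ⁰₁ : ∀ L → (ℕ → Rel (Structure L) 0ℓ) → Set
IsΣ⁰₁ L A = ∃[ c ] (∀ n x y →
  A n x y ⇔ (∃[ m ] ((toCantor L x ⊕ toCantor L y) ⊢ c ∙ n ↓ m)))

IsΠ⁰₂ : ∀ L → Rel (Structure L) 0ℓ → Set₁
IsΠ⁰₂ L B = ∃[ A ] IsΣ⁰₁ L A × (∀ x y → B x y ⇔ (∀ n → A n x y))

module _ {X : Set} (_≈_ : Rel X 0ℓ) (G : Rel X 0ℓ) where

  IsSimpleGraph : Set
  IsSimpleGraph = Irreflexive _≈_ G × Symmetric G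

  data Path : ℕ → Rel X 0ℓ where
    stop : ∀ {x y} → x ≈ y → Path 0 x y
    step : ∀ {n x y z} → G x y → Path n y z → Path (suc n) x z

  Connected : Rel X 0ℓ
  Connected x y = ∃[ n ] Path n x y

  DiameterAtMost : ℕ → Set
  DiameterAtMost k = ∀ x y → Connected x y → ∃[ n ] n ≤ k × Path n x y

  HasDiameter : ℕ → Set
  HasDiameter k = DiameterAtMost k × (∀ l → DiameterAtMost l → k ≤ l)

Π⁰₂-GraphableWithDiameter : ∀ L → Rel (Structure L) 0ℓ → ℕ → Set₁
Π⁰₂-GraphableWithDiameter L E k = ∃[ G ]
  IsSimpleGraph _≈_ G ×
  IsΠ⁰₂ L G ×
  (∀ x y → E x y ⇔ Connected _≈_ G x y) ×
  HasDiameter _≈_ G k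
  where
  _≈_ : Rel (Structure L) 0ℓ
  _≈_ = SameStructure L

{-# OPTIONS --safe #-}
module Submission where

open import Level using (0ℓ)
open import Axiom.ExcludedMiddle using (ExcludedMiddle)
open import Data.Bool using (Bool; true; false; if_then_else_)
open import Data.Fin using (Fin; zero; suc; _↑ʳ_)
open import Data.Fin.Properties using (fromℕ<-toℕ; toℕ-fromℕ<; toℕ<n)
open import Data.List using (List; []; _∷_)
open import Data.Maybe using (just; nothing)
open import Data.Nat using (ℕ; zero; suc; pred; _+_; _∸_; _⊔_; _≤_; _<_; z≤n; s≤s; s≤s⁻¹; _≟_; _≤?_; _<?_)
open import Data.Nat.GeneralisedArithmetic using (fold; fold-+; iterate; iterate-is-fold)
open import Data.Nat.Properties hiding (_≟_; _≤?_; _<?_)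
open import Data.Product using (_×_; _,_; proj₁; proj₂; ∃-syntax)
open import Data.Sum as Sum using (_⊎_; inj₁; inj₂; [_,_]′)
open import Data.Vec using (Vec; []; _∷_; map; lookup; replicate; tabulate)
open import Data.Vec.Properties using (map-id; map-∘; map-cong; tabulate∘lookup)
open import Function using (_∘_; id)
open import Function.Bundles using (_⇔_; mk⇔; Equivalence)
open import Function.Consequences.Propositional using (inverseᵇ⇒bijective; strictlySurjective⇒surjective)
open import Function.Construct.Composition using () renaming (bijective to ∘-bijective)
open import Function.Definitions using (Bijective; Injective)
open import Relation.Binary.Definitions using (tri<; tri≈; tri>)
open import Relation.Binary.PropositionalEquality hiding ([_])
open import Relation.Nullary using (¬_; Dec; does; yes; no; contradiction)
open import Relation.Nullary.Decidable using (dec-true; dec-false; decidable-stable; toSum)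
open import Defs

open Equivalence using (to; from)

-- Call j the number carried by z when j is the first of a list of tests that z passes.
-- The number j = ⟨ p , e ⟩ has room for an arbitrary e, in particular for programs.
-- If y is not fixed by all permutations, then for some p and every e there is a
-- finite permutation of y that carries ⟨ p , e ⟩: far out every pattern takes
-- one of its values unboundedly often, so all tests before j can be made to fail.
-- Join y to z when some program in the number j of z computes a bijection f for which
-- z is y ∘ f ∘ τ, where τ is the first finite permutation for which this structure
-- carries j.  As j and τ are determined by y and z, this is Π⁰₂.  If f is a
-- computable isomorphism from x to y, then both x and y are joined to the permutation
-- of x that carries programs for the identity and for f.

-- That some program computes an isomorphism is a Σ⁰₃ statement: the program is guessed once, before
-- its totality is checked. Storing the program in an endpoint moves the guess behind the universal
-- quantifier, where it may be repeated for each n. A test compares two copies of a pattern instead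
-- of reading one value, because the value that recurs far out depends on the structure and the
-- pattern; two copies that both have it agree, whichever it is. To be made to pass, a pattern must
-- take both values. Two distinct isomorphic structures provide one: a bit where they differ is a
-- pattern of the first that changes its value along the isomorphism. Every edge has an endpoint
-- that carries a number. Hence distinct isomorphic structures that carry none are not joined, and
-- this is why length 1 does not suffice.

-- Cantor's pairing.

triangle-suc : ∀ a b → triangle (a + suc b) + suc b ≡ suc (triangle (suc a + b) + b)
triangle-suc a b = trans (+-suc _ b) (cong (λ s → suc (triangle s + b)) (+-suc a b))

-- Induction on `b` walks along one antidiagonal from its start (a + b , 0); the end of each
-- antidiagonal then yields the start of the next.
unpair-⟨⟩-row : ∀ a b → unpair (triangle (a + b)) ≡ (a + b , 0) → unpair ⟨ a , b ⟩ ≡ (a , b)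
unpair-⟨⟩-row a zero    row rewrite +-identityʳ (triangle (a + 0)) = trans row (cong (_, 0) (+-identityʳ a))
unpair-⟨⟩-row a (suc b) row rewrite triangle-suc a b
  = cong next (unpair-⟨⟩-row (suc a) b (subst (λ s → unpair (triangle s) ≡ (s , 0)) (+-suc a b) row))

unpair-triangle : ∀ s → unpair (triangle s) ≡ (s , 0)
unpair-triangle zero    = refl
unpair-triangle (suc s) rewrite +-comm s (triangle s)
  = cong next (unpair-⟨⟩-row 0 s (unpair-triangle s))

unpair-⟨⟩ : ∀ a b → unpair ⟨ a , b ⟩ ≡ (a , b)
unpair-⟨⟩ a b = unpair-⟨⟩-row a b (unpair-triangle (a + b))

⟨next⟩ : ∀ a b → ⟨ proj₁ (next (a , b)) , proj₂ (next (a , b)) ⟩ ≡ suc ⟨ a , b ⟩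
⟨next⟩ zero    b = trans (+-identityʳ _) (trans (cong (λ s → triangle (suc s)) (+-identityʳ b)) (cong suc (+-comm b _)))
⟨next⟩ (suc a) b = triangle-suc a b

⟨unpair⟩ : ∀ n → ⟨ proj₁ (unpair n) , proj₂ (unpair n) ⟩ ≡ n
⟨unpair⟩ zero    = refl
⟨unpair⟩ (suc n) = trans (⟨next⟩ (proj₁ (unpair n)) (proj₂ (unpair n))) (cong suc (⟨unpair⟩ n))

n≤triangle : ∀ n → n ≤ triangle n
n≤triangle zero    = z≤n
n≤triangle (suc n) = m≤m+n (suc n) _

triangle-mono : ∀ {m n} → m ≤ n → triangle m ≤ triangle n
triangle-mono z≤n       = z≤n
triangle-mono (s≤s m≤n) = +-mono-≤ (s≤s m≤n) (triangle-mono m≤n)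

-- The pairing is sealed so that it never unfolds to arithmetic on diagonals.

infixr 6 _,ℕ_

opaque
  _,ℕ_ : ℕ → ℕ → ℕ
  a ,ℕ b = ⟨ a , b ⟩

  π₁ π₂ : ℕ → ℕ
  π₁ n = proj₁ (unpair n)
  π₂ n = proj₂ (unpair n)

  π₁-, : ∀ a b → π₁ (a ,ℕ b) ≡ a
  π₁-, a b = cong proj₁ (unpair-⟨⟩ a b)

  π₂-, : ∀ a b → π₂ (a ,ℕ b) ≡ b
  π₂-, a b = cong proj₂ (unpair-⟨⟩ a b)

  ,-π : ∀ n → (π₁ n ,ℕ π₂ n) ≡ n
  ,-π = ⟨unpair⟩

  ,ℕ-mono : ∀ {a b c d} → a ≤ c → b ≤ d → (a ,ℕ b) ≤ (c ,ℕ d)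
  ,ℕ-mono a≤c b≤d = +-mono-≤ (triangle-mono (+-mono-≤ a≤c b≤d)) b≤d

  ≤-,₁ : ∀ a b → a ≤ (a ,ℕ b)
  ≤-,₁ a b = ≤-trans (m≤m+n a b) (≤-trans (n≤triangle (a + b)) (m≤m+n _ b))

  ≤-,₂ : ∀ a b → b ≤ (a ,ℕ b)
  ≤-,₂ a b = m≤n+m b _

  ,ℕ-def : ∀ a b → (a ,ℕ b) ≡ ⟨ a , b ⟩
  ,ℕ-def a b = refl

  π₁-def : ∀ n → π₁ n ≡ proj₁ (unpair n)
  π₁-def n = refl

  π₂-def : ∀ n → π₂ n ≡ proj₂ (unpair n)
  π₂-def n = refl

  π₁-0 : π₁ 0 ≡ 0
  π₁-0 = refl

π₁≤ : ∀ n → π₁ n ≤ n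
π₁≤ n = subst (π₁ n ≤_) (,-π n) (≤-,₁ (π₁ n) (π₂ n))

π₂≤ : ∀ n → π₂ n ≤ n
π₂≤ n = subst (π₂ n ≤_) (,-π n) (≤-,₂ (π₁ n) (π₂ n))

-- Programs: determinism and change of oracle.

mutual
  ↓-functional : ∀ {α} c {n m m′} → α ⊢ c ∙ n ↓ m → α ⊢ c ∙ n ↓ m′ → m ≡ m′
  ↓-functional zero   p q = trans p (sym q)
  ↓-functional succ   p q = trans p (sym q)
  ↓-functional left   p q = trans p (sym q)
  ↓-functional right  p q = trans p (sym q)
  ↓-functional oracle p q = trans p (sym q)
  ↓-functional (pair c d) (_ , _ , pa , pb , refl) (_ , _ , qa , qb , refl) =
    cong₂ ⟨_,_⟩ (↓-functional c pa qa) (↓-functional d pb qb)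
  ↓-functional (comp c d) (_ , pd , pc) (_ , qd , qc) with ↓-functional d pd qd
  ... | refl = ↓-functional c pc qc
  ↓-functional (prec c d) {n} p q = PrimRec-functional c d (proj₂ (unpair n)) p q
  ↓-functional (μ c) {m = m} {m′} (p₀ , p<) (q₀ , q<) with <-cmp m m′
  ... | tri< m<m′ _ _ = contradiction (↓-functional c p₀ (proj₂ (q< m m<m′))) λ ()
  ... | tri≈ _ m≡m′ _ = m≡m′
  ... | tri> _ _ m′<m = contradiction (↓-functional c q₀ (proj₂ (p< m′ m′<m))) λ ()

  PrimRec-functional : ∀ {α} c d {a} n {m m′} →
    PrimRec (α ⊢ c ∙_↓_) (α ⊢ d ∙_↓_) a n m → PrimRec (α ⊢ c ∙_↓_) (α ⊢ d ∙_↓_) a n m′ → m ≡ m′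
  PrimRec-functional c d zero p q = ↓-functional c p q
  PrimRec-functional c d (suc n) (_ , p , p′) (_ , q , q′) with PrimRec-functional c d n p q
  ... | refl = ↓-functional d p′ q′

-- Computability refers to the constant oracle, while the program for the graph has two structures
-- as oracle. The constant oracle answers 0, so with `zero` in place of each question the run is the
-- same under any oracle.
strip : Code → Code
strip zero       = zero
strip succ       = succ
strip left       = left
strip right      = right
strip oracle     = zero
strip (pair c d) = pair (strip c) (strip d)
strip (comp c d) = comp (strip c) (strip d)
strip (prec c d) = prec (strip c) (strip d)
strip (μ c)      = μ (strip c)

no-oracle : Cantor
no-oracle _ = false

mutual
  ↓-strip : ∀ {α} c {n m} → no-oracle ⊢ c ∙ n ↓ m → α ⊢ strip c ∙ n ↓ m
  ↓-strip zero   p = p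
  ↓-strip succ   p = p
  ↓-strip left   p = p
  ↓-strip right  p = p
  ↓-strip oracle p = p
  ↓-strip (pair c d) (a , b , p , q , eq) = a , b , ↓-strip c p , ↓-strip d q , eq
  ↓-strip (comp c d) (k , p , q) = k , ↓-strip d p , ↓-strip c q
  ↓-strip (prec c d) {n} p = PrimRec-strip c d (proj₂ (unpair n)) p
  ↓-strip (μ c) (p , q) = ↓-strip c p , λ k k<m → proj₁ (q k k<m) , ↓-strip c (proj₂ (q k k<m))

  PrimRec-strip : ∀ {α} c d {a} n {m} →
    PrimRec (no-oracle ⊢ c ∙_↓_) (no-oracle ⊢ d ∙_↓_) a n m →
    PrimRec (α ⊢ strip c ∙_↓_) (α ⊢ strip d ∙_↓_) a n m
  PrimRec-strip c d zero    p           = ↓-strip c p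
  PrimRec-strip c d (suc n) (k , p , q) = k , PrimRec-strip c d n p , ↓-strip d q

-- A small language of total functions with an oracle, compiled to codes.

bit : Bool → ℕ
bit b = if b then 1 else 0

ifz : ℕ → ℕ → ℕ → ℕ
ifz zero    a b = a
ifz (suc _) a b = b

primRec : ℕ → (ℕ → ℕ → ℕ) → ℕ → ℕ
primRec a f zero    = a
primRec a f (suc n) = f n (primRec a f n)

-- A new variable leaves the old environment intact as the left component, so weakening compiles to
-- `left`.
env : ∀ {k} → Vec ℕ k → ℕ
env []      = 0
env (x ∷ ρ) = env ρ ,ℕ x

Represented : ∀ {k} → (Cantor → Vec ℕ k → ℕ) → Set
Represented f = ∃[ c ] (∀ α ρ → α ⊢ c ∙ env ρ ↓ f α ρ)

-- `fn` carries a function together with a program for it, so that `eval` returns the function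
-- itself and not the recursion that computes it.
data Term : ℕ → Set where
  var   : ∀ {k} → Fin k → Term k
  nat   : ∀ {k} → ℕ → Term k
  sucᵗ  : ∀ {k} → Term k → Term k
  _,ᵗ_  : ∀ {k} → Term k → Term k → Term k
  π₁ᵗ   : ∀ {k} → Term k → Term k
  π₂ᵗ   : ∀ {k} → Term k → Term k
  askᵗ  : ∀ {k} → Term k → Term k
  ifzᵗ  : ∀ {k} → Term k → Term k → Term k → Term k
  recᵗ  : ∀ {k} → Term k → Term (suc (suc k)) → Term k → Term k
  fn    : ∀ {k m} (f : Cantor → Vec ℕ m → ℕ) → Represented f → Vec (Term k) m → Term k
  unary : ∀ {k f} → Computable f → Term k → Term k
  wk    : ∀ {k} → Term k → Term (suc k)

infixr 6 _,ᵗ_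

mutual
  eval : ∀ {k} → Term k → Cantor → Vec ℕ k → ℕ
  eval (var i)       α ρ = lookup ρ i
  eval (nat n)       α ρ = n
  eval (sucᵗ t)      α ρ = suc (eval t α ρ)
  eval (t ,ᵗ s)      α ρ = eval t α ρ ,ℕ eval s α ρ
  eval (π₁ᵗ t)       α ρ = π₁ (eval t α ρ)
  eval (π₂ᵗ t)       α ρ = π₂ (eval t α ρ)
  eval (askᵗ t)      α ρ = bit (α (eval t α ρ))
  eval (ifzᵗ t s u)  α ρ = ifz (eval t α ρ) (eval s α ρ) (eval u α ρ)
  eval (recᵗ s u t)  α ρ = primRec (eval s α ρ) (λ i r → eval u α (r ∷ i ∷ ρ)) (eval t α ρ)
  eval (fn f _ ts)   α ρ = f α (evals ts α ρ)
  eval (unary {f = f} _ t) α ρ = f (eval t α ρ)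
  eval (wk t)        α (_ ∷ ρ) = eval t α ρ

  evals : ∀ {k m} → Vec (Term k) m → Cantor → Vec ℕ k → Vec ℕ m
  evals []       α ρ = []
  evals (t ∷ ts) α ρ = eval t α ρ ∷ evals ts α ρ

compile-var : ∀ {k} → Fin k → Code
compile-var zero    = right
compile-var (suc i) = comp (compile-var i) left

compile-nat : ℕ → Code
compile-nat zero    = zero
compile-nat (suc n) = comp succ (compile-nat n)

mutual
  compile : ∀ {k} → Term k → Code
  compile (var i)      = compile-var i
  compile (nat n)      = compile-nat n
  compile (sucᵗ t)     = comp succ (compile t)
  compile (t ,ᵗ s)     = pair (compile t) (compile s)
  compile (π₁ᵗ t)      = comp left (compile t)
  compile (π₂ᵗ t)      = comp right (compile t)
  compile (askᵗ t)     = comp oracle (compile t)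
  compile (ifzᵗ t s u) =
    -- A case distinction is a recursion whose step ignores the counter and the previous value;
    -- `left` recovers the environment.
    comp (prec (compile s) (comp (compile u) left)) (pair (pair left right) (compile t))
  compile (recᵗ s u t) =
    comp (prec (compile s)
               (comp (compile u) (pair (pair left (comp left right)) (comp right right))))
         (pair (pair left right) (compile t))
  compile (fn _ (c , _) ts) = comp c (compiles ts)
  compile (unary (c , _) t) = comp (strip c) (compile t)
  compile (wk t)       = comp (compile t) left

  compiles : ∀ {k m} → Vec (Term k) m → Code
  compiles []       = zero
  compiles (t ∷ ts) = pair (compiles ts) (compile t)

opaque
  unfolding _,ℕ_

  var-correct : ∀ {k} (i : Fin k) α ρ → α ⊢ compile-var i ∙ env ρ ↓ lookup ρ i
  var-correct zero    α (x ∷ ρ) = sym (π₂-, (env ρ) x)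
  var-correct (suc i) α (x ∷ ρ) = env ρ , sym (π₁-, (env ρ) x) , var-correct i α ρ

  nat-correct : ∀ n {α x} → α ⊢ compile-nat n ∙ x ↓ n
  nat-correct zero    = refl
  nat-correct (suc n) = n , nat-correct n , refl

  PrimRec-primRec : ∀ {F G : ℕ → ℕ → Set} {a b} {g : ℕ → ℕ → ℕ} → F a b →
    (∀ i r → G ⟨ a , ⟨ i , r ⟩ ⟩ (g i r)) → ∀ n → PrimRec F G a n (primRec b g n)
  PrimRec-primRec F↓ G↓ zero    = F↓
  PrimRec-primRec F↓ G↓ (suc n) = _ , PrimRec-primRec F↓ G↓ n , G↓ n _

  ifz-primRec : ∀ n a b → primRec a (λ _ _ → b) n ≡ ifz n a b
  ifz-primRec zero    a b = refl
  ifz-primRec (suc n) a b = refl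

  -- The input of a recursion is paired up again to save a constructor for the identity.
  repair : ∀ {α} n → α ⊢ pair left right ∙ n ↓ n
  repair n = _ , _ , refl , refl , sym (⟨unpair⟩ n)

  rec-correct : ∀ {α} c d a b g → α ⊢ c ∙ a ↓ b →
    (∀ i r → α ⊢ d ∙ ⟨ a , ⟨ i , r ⟩ ⟩ ↓ g i r) →
    ∀ n → α ⊢ prec c d ∙ ⟨ a , n ⟩ ↓ primRec b g n
  rec-correct {α} c d a b g base ind n rewrite unpair-⟨⟩ a n =
    PrimRec-primRec {α ⊢ c ∙_↓_} {α ⊢ d ∙_↓_} base ind n

  reassociate : ∀ {α} a i r →
    α ⊢ pair (pair left (comp left right)) (comp right right) ∙ ⟨ a , ⟨ i , r ⟩ ⟩ ↓ ⟨ ⟨ a , i ⟩ , r ⟩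
  reassociate a i r rewrite unpair-⟨⟩ a ⟨ i , r ⟩ =
    _ , _ ,
    (_ , _ , refl , (_ , refl , refl) , refl) , (_ , refl , refl) ,
    cong₂ (λ x y → ⟨ ⟨ a , x ⟩ , y ⟩) (sym (π₁-, i r)) (sym (π₂-, i r))

  mutual
    compile-correct : ∀ {k} (t : Term k) α ρ → α ⊢ compile t ∙ env ρ ↓ eval t α ρ
    compile-correct (var i)  α ρ = var-correct i α ρ
    compile-correct (nat n)  α ρ = nat-correct n
    compile-correct (sucᵗ t) α ρ = _ , compile-correct t α ρ , refl
    compile-correct (t ,ᵗ s) α ρ =
      _ , _ , compile-correct t α ρ , compile-correct s α ρ , refl
    compile-correct (π₁ᵗ t)  α ρ = _ , compile-correct t α ρ , refl
    compile-correct (π₂ᵗ t)  α ρ = _ , compile-correct t α ρ , refl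
    compile-correct (askᵗ t) α ρ = _ , compile-correct t α ρ , refl
    compile-correct (ifzᵗ t s u) α ρ = _ ,
      (_ , _ , repair {α} (env ρ) , compile-correct t α ρ , refl) ,
      subst (α ⊢ prec (compile s) (comp (compile u) left) ∙ ⟨ env ρ , eval t α ρ ⟩ ↓_)
        (ifz-primRec (eval t α ρ) (eval s α ρ) (eval u α ρ))
        (rec-correct (compile s) (comp (compile u) left) (env ρ) (eval s α ρ) (λ _ _ → eval u α ρ)
          (compile-correct s α ρ)
          (λ i r → env ρ , sym (π₁-, (env ρ) ⟨ i , r ⟩) , compile-correct u α ρ)
          (eval t α ρ))
    compile-correct (recᵗ s u t) α ρ = _ ,
      (_ , _ , repair {α} (env ρ) , compile-correct t α ρ , refl) ,
      rec-correct (compile s)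
        (comp (compile u) (pair (pair left (comp left right)) (comp right right)))
        (env ρ) (eval s α ρ) (λ i r → eval u α (r ∷ i ∷ ρ))
        (compile-correct s α ρ)
        (λ i r → _ , reassociate {α} (env ρ) i r , compile-correct u α (r ∷ i ∷ ρ))
        (eval t α ρ)
    compile-correct (fn f (c , c↓f) ts) α ρ = _ , compiles-correct ts α ρ , c↓f α _
    compile-correct (unary (c , c↓f) t) α ρ = _ , compile-correct t α ρ , ↓-strip c (c↓f _)
    compile-correct (wk t) α (x ∷ ρ) = env ρ , sym (π₁-, (env ρ) x) , compile-correct t α ρ

    compiles-correct : ∀ {k m} (ts : Vec (Term k) m) α ρ →
      α ⊢ compiles ts ∙ env ρ ↓ env (evals ts α ρ)
    compiles-correct []       α ρ = refl
    compiles-correct (t ∷ ts) α ρ =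
      _ , _ , compiles-correct ts α ρ , compile-correct t α ρ , refl

represented : ∀ {k} (t : Term k) → Represented (eval t)
represented t = compile t , compile-correct t

represented-as : ∀ {k} (t : Term k) {f : Cantor → Vec ℕ k → ℕ} →
  (∀ α ρ → eval t α ρ ≡ f α ρ) → Represented f
represented-as t t≡f =
  compile t , λ α ρ → subst (α ⊢ compile t ∙ env ρ ↓_) (t≡f α ρ) (compile-correct t α ρ)

call : ∀ {k m} → Term m → Vec (Term k) m → Term k
call t = fn (eval t) (represented t)

predᵗ : ∀ {k} → Term k → Term k
predᵗ = recᵗ (nat 0) (var (suc zero))

_∸ᵗ_ : ∀ {k} → Term k → Term k → Term k
t ∸ᵗ s = recᵗ t (predᵗ (var zero)) s

∸ᵗ-correct : ∀ {k} (t s : Term k) α ρ → eval (t ∸ᵗ s) α ρ ≡ eval t α ρ ∸ eval s α ρ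
∸ᵗ-correct t s α ρ = go (eval s α ρ)
  where
  predᵗ-correct : ∀ n → primRec 0 (λ i _ → i) n ≡ pred n
  predᵗ-correct zero    = refl
  predᵗ-correct (suc n) = refl
  go : ∀ n → primRec (eval t α ρ) (λ _ r → primRec 0 (λ i _ → i) r) n ≡ eval t α ρ ∸ n
  go zero    = refl
  go (suc n) = trans (predᵗ-correct (primRec (eval t α ρ) (λ _ r → primRec 0 (λ i _ → i) r) n)) (trans (cong pred (go n)) (pred[m∸n]≡m∸[1+n] (eval t α ρ) n))

-- Bounded formulas, their decision and unbounded search.

infix  5 _≐_
infixr 4 _∧ᶠ_
infixr 3 _∨ᶠ_

data Formula (k : ℕ) : Set where
  _≐_  : Term k → Term k → Formula k
  _∧ᶠ_ : Formula k → Formula k → Formula k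
  _∨ᶠ_ : Formula k → Formula k → Formula k
  ¬ᶠ_  : Formula k → Formula k
  all< : Term k → Formula (suc k) → Formula k
  _at_ : ∀ {m} → Formula m → Vec (Term k) m → Formula k

⟦_⟧ : ∀ {k} → Formula k → Cantor → Vec ℕ k → Set
⟦ t ≐ s ⟧    α ρ = eval t α ρ ≡ eval s α ρ
⟦ φ ∧ᶠ ψ ⟧   α ρ = ⟦ φ ⟧ α ρ × ⟦ ψ ⟧ α ρ
⟦ φ ∨ᶠ ψ ⟧   α ρ = ⟦ φ ⟧ α ρ ⊎ ⟦ ψ ⟧ α ρ
⟦ ¬ᶠ φ ⟧     α ρ = ¬ ⟦ φ ⟧ α ρ
⟦ all< t φ ⟧ α ρ = ∀ i → i < eval t α ρ → ⟦ φ ⟧ α (i ∷ ρ)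
⟦ φ at ts ⟧  α ρ = ⟦ φ ⟧ α (evals ts α ρ)

-- Characteristic terms: a formula holds where its term vanishes.

χ : ∀ {k} → Formula k → Term k
χ (t ≐ s)    = ifzᵗ (t ∸ᵗ s) (s ∸ᵗ t) (nat 1)
χ (φ ∧ᶠ ψ)   = ifzᵗ (χ φ) (χ ψ) (nat 1)
χ (φ ∨ᶠ ψ)   = ifzᵗ (χ φ) (nat 0) (χ ψ)
χ (¬ᶠ φ)     = ifzᵗ (χ φ) (nat 1) (nat 0)
-- The accumulator stays 1 after the first failure; `wk` hides it from `φ`, which expects only the
-- index in front.
χ (all< t φ) = recᵗ (nat 0) (ifzᵗ (var zero) (wk (χ φ)) (nat 1)) t
χ (φ at ts)  = call (χ φ) ts

mutual
  χ-complete : ∀ {k} (φ : Formula k) {α ρ} → ⟦ φ ⟧ α ρ → eval (χ φ) α ρ ≡ 0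
  χ-complete (t ≐ s) {α} {ρ} p
    rewrite ∸ᵗ-correct t s α ρ | ∸ᵗ-correct s t α ρ | p | n∸n≡0 (eval s α ρ) = refl
  χ-complete (φ ∧ᶠ ψ) (p , q) rewrite χ-complete φ p = χ-complete ψ q
  χ-complete (φ ∨ᶠ ψ) (inj₁ p) rewrite χ-complete φ p = refl
  χ-complete (φ ∨ᶠ ψ) {α} {ρ} (inj₂ q) with eval (χ φ) α ρ
  ... | zero  = refl
  ... | suc _ = χ-complete ψ q
  χ-complete (¬ᶠ φ) {α} {ρ} ¬p with eval (χ φ) α ρ in eq
  ... | zero  = contradiction (χ-sound φ eq) ¬p
  ... | suc _ = refl
  χ-complete (all< t φ) {α} {ρ} p = go (eval t α ρ) p
    where
    go : ∀ n → (∀ i → i < n → ⟦ φ ⟧ α (i ∷ ρ)) →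
      primRec 0 (λ i r → ifz r (eval (χ φ) α (i ∷ ρ)) 1) n ≡ 0
    go zero    _ = refl
    go (suc n) p rewrite go n (λ i i<n → p i (m≤n⇒m≤1+n i<n)) = χ-complete φ (p n ≤-refl)
  χ-complete (φ at ts) p = χ-complete φ p

  χ-sound : ∀ {k} (φ : Formula k) {α ρ} → eval (χ φ) α ρ ≡ 0 → ⟦ φ ⟧ α ρ
  χ-sound (t ≐ s) {α} {ρ} eq
    rewrite ∸ᵗ-correct t s α ρ | ∸ᵗ-correct s t α ρ
    with eval t α ρ ∸ eval s α ρ in t∸s
  ... | zero = ≤-antisym (m∸n≡0⇒m≤n t∸s) (m∸n≡0⇒m≤n eq)
  χ-sound (φ ∧ᶠ ψ) {α} {ρ} eq with eval (χ φ) α ρ in eqφ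
  ... | zero = χ-sound φ eqφ , χ-sound ψ eq
  χ-sound (φ ∨ᶠ ψ) {α} {ρ} eq with eval (χ φ) α ρ in eqφ
  ... | zero  = inj₁ (χ-sound φ eqφ)
  ... | suc _ = inj₂ (χ-sound ψ eq)
  χ-sound (¬ᶠ φ) {α} {ρ} eq p rewrite χ-complete φ p with () ← eq
  χ-sound (all< t φ) {α} {ρ} eq i i<n = go (eval t α ρ) eq i i<n
    where
    go : ∀ n → primRec 0 (λ i r → ifz r (eval (χ φ) α (i ∷ ρ)) 1) n ≡ 0 →
      ∀ i → i < n → ⟦ φ ⟧ α (i ∷ ρ)
    go (suc n) eq i i<1+n
      with primRec 0 (λ i r → ifz r (eval (χ φ) α (i ∷ ρ)) 1) n in eqn
    ... | zero with m≤n⇒m<n∨m≡n (s≤s⁻¹ i<1+n)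
    ...   | inj₁ i<n  = go n eqn i i<n
    ...   | inj₂ refl = χ-sound φ eq
  χ-sound (φ at ts) eq = χ-sound φ eq

least-zero : ∀ (h : ℕ → ℕ) m → h m ≡ 0 →
  ∃[ l ] h l ≡ 0 × (∀ k → k < l → ∃[ v ] h k ≡ suc v)
least-zero h zero    hm = 0 , hm , λ _ ()
least-zero h (suc m) hm with h 0 in h0
... | zero  = 0 , h0 , λ _ ()
... | suc v with least-zero (h ∘ suc) m hm
...   | l , hl , below =
  suc l , hl , λ { zero _ → v , h0 ; (suc k) (s≤s k<l) → below k k<l }

-- The body of `μ` receives ⟨ n , m ⟩, whereas the environment of m and n is ⟨ ⟨ 0 , n ⟩ , m ⟩.
search : Formula 2 → Code
search φ = μ (comp (compile (χ φ)) (pair (pair zero left) right))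

opaque
  unfolding _,ℕ_

  search-step : ∀ (φ : Formula 2) α n m →
    α ⊢ comp (compile (χ φ)) (pair (pair zero left) right) ∙ ⟨ n , m ⟩ ↓ eval (χ φ) α (m ∷ n ∷ [])
  search-step φ α n m = _ ,
    (_ , _ , (_ , _ , refl , refl , refl) , refl ,
     cong₂ ⟨_,_⟩ (cong ⟨ 0 ,_⟩ (sym (π₁-, n m))) (sym (π₂-, n m))) ,
    compile-correct (χ φ) α (m ∷ n ∷ [])

search-halts : ∀ φ α n m → ⟦ φ ⟧ α (m ∷ n ∷ []) → ∃[ l ] (α ⊢ search φ ∙ n ↓ l)
search-halts φ α n m p with least-zero (λ m → eval (χ φ) α (m ∷ n ∷ [])) m (χ-complete φ p)
... | l , l≡0 , below = l ,
  subst (α ⊢ body ∙ ⟨ n , l ⟩ ↓_) l≡0 (search-step φ α n l) ,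
  λ k k<l → proj₁ (below k k<l) ,
    subst (α ⊢ body ∙ ⟨ n , k ⟩ ↓_) (proj₂ (below k k<l)) (search-step φ α n k)
  where
  body : Code
  body = comp (compile (χ φ)) (pair (pair zero left) right)

search-sound : ∀ φ α n l → α ⊢ search φ ∙ n ↓ l → ⟦ φ ⟧ α (l ∷ n ∷ [])
search-sound φ α n l (p , _) = χ-sound φ
  (↓-functional (comp (compile (χ φ)) (pair (pair zero left) right)) {⟨ n , l ⟩} (search-step φ α n l) p)

computable-search : ∀ (φ : Formula 2) → (∀ n → ∃[ m ] ⟦ φ ⟧ no-oracle (m ∷ n ∷ [])) →
  ∃[ h ] Computable h × (∀ n → ⟦ φ ⟧ no-oracle (h n ∷ n ∷ []))
computable-search φ total =
  (λ n → proj₁ (halts n)) , (search φ , λ n → proj₂ (halts n)) ,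
  λ n → search-sound φ no-oracle n _ (proj₂ (halts n))
  where
  halts : ∀ n → ∃[ l ] (no-oracle ⊢ search φ ∙ n ↓ l)
  halts n = search-halts φ no-oracle n _ (proj₂ (total n))

pattern #0 = var zero
pattern #1 = var (suc zero)
pattern #2 = var (suc (suc zero))
pattern #3 = var (suc (suc (suc zero)))
pattern #4 = var (suc (suc (suc (suc zero))))
pattern #5 = var (suc (suc (suc (suc (suc zero)))))

fold-representable : (t : Term 1) →
  Represented {2} λ { α (n ∷ z ∷ []) → fold z (λ x → eval t α (x ∷ [])) n }
fold-representable t = represented-as (recᵗ #1 (call t (#0 ∷ [])) #0) λ { α (n ∷ z ∷ []) → go α z n }
  where
  go : ∀ α z n → primRec z (λ _ x → eval t α (x ∷ [])) n ≡ fold z (λ x → eval t α (x ∷ [])) n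
  go α z zero    = refl
  go α z (suc n) = cong (λ x → eval t α (x ∷ [])) (go α z n)

foldᵗ : ∀ {k} → Term 1 → Term k → Term k → Term k
foldᵗ t n z = fn _ (fold-representable t) (n ∷ z ∷ [])

-- A stack machine that evaluates codes.  A state is a value together with a
-- stack of frames ⟨ tag , argument ⟩; it has halted when the top tag is 0,
-- which is how the empty stack 0 reads.

encode : Code → ℕ
encode zero       = 1 ,ℕ 0
encode succ       = 2 ,ℕ 0
encode left       = 3 ,ℕ 0
encode right      = 4 ,ℕ 0
-- Only runs with the constant oracle are simulated; there a question returns 0, as `zero` does.
encode oracle     = 1 ,ℕ 0
encode (pair c d) = 5 ,ℕ encode c ,ℕ encode d
encode (comp c d) = 8 ,ℕ encode c ,ℕ encode d
encode (prec c d) = 9 ,ℕ encode c ,ℕ encode d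
encode (μ c)      = 11 ,ℕ encode c

switchᵗ : ∀ {k} → Term k → List (Term k) → Term k
switchᵗ t []       = nat 0
switchᵗ t (u ∷ us) = ifzᵗ t u (switchᵗ (predᵗ t) us)

-- The variables are the value, the predecessor of the top tag, the argument of
-- the top frame and the rest of the stack.
dispatchᵗ : Term 4
dispatchᵗ = switchᵗ #1
  ( nat 0 ,ᵗ rest                                                        -- 1: zero
  ∷ sucᵗ v ,ᵗ rest                                                       -- 2: succ
  ∷ π₁ᵗ v ,ᵗ rest                                                        -- 3: left
  ∷ π₂ᵗ v ,ᵗ rest                                                        -- 4: right
  ∷ v ,ᵗ π₁ᵗ arg ,ᵗ (nat 6 ,ᵗ π₂ᵗ arg ,ᵗ v) ,ᵗ rest                      -- 5: pair c d
  ∷ π₂ᵗ arg ,ᵗ π₁ᵗ arg ,ᵗ (nat 7 ,ᵗ v) ,ᵗ rest                           -- 6: pair, first value found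
  ∷ (arg ,ᵗ v) ,ᵗ rest                                                   -- 7: pair, both values found
  ∷ v ,ᵗ π₂ᵗ arg ,ᵗ π₁ᵗ arg ,ᵗ rest                                      -- 8: comp c d
  ∷ π₁ᵗ v ,ᵗ π₁ᵗ arg ,ᵗ
      (nat 10 ,ᵗ (π₂ᵗ arg ,ᵗ π₁ᵗ v) ,ᵗ nat 0 ,ᵗ π₂ᵗ v) ,ᵗ rest           -- 9: prec c d
  ∷ ifzᵗ todo (v ,ᵗ rest)
      ((π₂ᵗ (π₁ᵗ arg) ,ᵗ done ,ᵗ v) ,ᵗ π₁ᵗ (π₁ᵗ arg) ,ᵗ
        (nat 10 ,ᵗ π₁ᵗ arg ,ᵗ sucᵗ done ,ᵗ predᵗ todo) ,ᵗ rest)          -- 10: loop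
  ∷ (v ,ᵗ nat 0) ,ᵗ arg ,ᵗ (nat 12 ,ᵗ arg ,ᵗ v ,ᵗ nat 0) ,ᵗ rest         -- 11: μ c
  ∷ ifzᵗ v (π₂ᵗ (π₂ᵗ arg) ,ᵗ rest)
      ((π₁ᵗ (π₂ᵗ arg) ,ᵗ sucᵗ (π₂ᵗ (π₂ᵗ arg))) ,ᵗ π₁ᵗ arg ,ᵗ
        (nat 12 ,ᵗ π₁ᵗ arg ,ᵗ π₁ᵗ (π₂ᵗ arg) ,ᵗ sucᵗ (π₂ᵗ (π₂ᵗ arg))) ,ᵗ rest)  -- 12: search
  ∷ [] )
  where
  v arg rest done todo : Term 4
  v    = #0
  arg  = #2
  rest = #3
  done = π₁ᵗ (π₂ᵗ arg)
  todo = π₂ᵗ (π₂ᵗ arg)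

tagᵗ : ∀ {k} → Term k → Term k
tagᵗ s = π₁ᵗ (π₁ᵗ (π₂ᵗ s))

tickᵗ : Term 1
tickᵗ = ifzᵗ (tagᵗ #0) #0
  (call dispatchᵗ (π₁ᵗ #0 ∷ predᵗ (tagᵗ #0) ∷ π₂ᵗ (π₁ᵗ (π₂ᵗ #0)) ∷ π₂ᵗ (π₂ᵗ #0) ∷ []))

tick : ℕ → ℕ
tick s = eval tickᵗ no-oracle (s ∷ [])

tag : ℕ → ℕ
tag s = π₁ (π₁ (π₂ s))

tick-frame : ∀ v t a k →
  tick (v ,ℕ (suc t ,ℕ a) ,ℕ k) ≡ eval dispatchᵗ no-oracle (v ∷ t ∷ a ∷ k ∷ [])
tick-frame v t a k
  rewrite π₁-, v ((suc t ,ℕ a) ,ℕ k) | π₂-, v ((suc t ,ℕ a) ,ℕ k)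
        | π₁-, (suc t ,ℕ a) k | π₂-, (suc t ,ℕ a) k | π₁-, (suc t) a | π₂-, (suc t) a = refl

infix 4 _⇝_

_⇝_ : ℕ → ℕ → Set
s ⇝ s′ = ∃[ t ] fold s tick t ≡ s′

⇝-trans : ∀ {s s′ s″} → s ⇝ s′ → s′ ⇝ s″ → s ⇝ s″
⇝-trans {s} (t , refl) (u , refl) = u + t , fold-+ s tick u

⇝-tick : ∀ {s s′ s″} → tick s ≡ s′ → s′ ⇝ s″ → s ⇝ s″
⇝-tick eq = ⇝-trans (1 , eq)

⇝-refl : ∀ {s} → s ⇝ s
⇝-refl = 0 , refl

tick-pair : ∀ v c d k → tick (v ,ℕ (5 ,ℕ c ,ℕ d) ,ℕ k) ≡ (v ,ℕ c ,ℕ (6 ,ℕ d ,ℕ v) ,ℕ k)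
tick-pair v c d k rewrite tick-frame v 4 (c ,ℕ d) k | π₁-, c d | π₂-, c d = refl

tick-pair₁ : ∀ a d v k → tick (a ,ℕ (6 ,ℕ d ,ℕ v) ,ℕ k) ≡ (v ,ℕ d ,ℕ (7 ,ℕ a) ,ℕ k)
tick-pair₁ a d v k rewrite tick-frame a 5 (d ,ℕ v) k | π₁-, d v | π₂-, d v = refl

tick-comp : ∀ v c d k → tick (v ,ℕ (8 ,ℕ c ,ℕ d) ,ℕ k) ≡ (v ,ℕ d ,ℕ c ,ℕ k)
tick-comp v c d k rewrite tick-frame v 7 (c ,ℕ d) k | π₁-, c d | π₂-, c d = refl

loop : ℕ → ℕ → ℕ → ℕ → ℕ
loop d a i j = 10 ,ℕ (d ,ℕ a) ,ℕ i ,ℕ j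

tick-prec : ∀ v c d k →
  tick (v ,ℕ (9 ,ℕ c ,ℕ d) ,ℕ k) ≡ (π₁ v ,ℕ c ,ℕ loop d (π₁ v) 0 (π₂ v) ,ℕ k)
tick-prec v c d k rewrite tick-frame v 8 (c ,ℕ d) k | π₁-, c d | π₂-, c d = refl

tick-loop-stop : ∀ v d a i k → tick (v ,ℕ loop d a i 0 ,ℕ k) ≡ (v ,ℕ k)
tick-loop-stop v d a i k
  rewrite tick-frame v 9 ((d ,ℕ a) ,ℕ i ,ℕ 0) k | π₂-, (d ,ℕ a) (i ,ℕ 0) | π₂-, i 0 = refl

tick-loop : ∀ v d a i j k →
  tick (v ,ℕ loop d a i (suc j) ,ℕ k) ≡ ((a ,ℕ i ,ℕ v) ,ℕ d ,ℕ loop d a (suc i) j ,ℕ k)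
tick-loop v d a i j k
  rewrite tick-frame v 9 ((d ,ℕ a) ,ℕ i ,ℕ suc j) k
        | π₁-, (d ,ℕ a) (i ,ℕ suc j) | π₂-, (d ,ℕ a) (i ,ℕ suc j)
        | π₁-, i (suc j) | π₂-, i (suc j) | π₁-, d a | π₂-, d a = refl

seek : ℕ → ℕ → ℕ → ℕ
seek c n i = 12 ,ℕ c ,ℕ n ,ℕ i

tick-seek-stop : ∀ c n i k → tick (0 ,ℕ seek c n i ,ℕ k) ≡ (i ,ℕ k)
tick-seek-stop c n i k
  rewrite tick-frame 0 11 (c ,ℕ n ,ℕ i) k | π₂-, c (n ,ℕ i) | π₂-, n i = refl

tick-seek : ∀ v c n i k →
  tick (suc v ,ℕ seek c n i ,ℕ k) ≡ ((n ,ℕ suc i) ,ℕ c ,ℕ seek c n (suc i) ,ℕ k)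
tick-seek v c n i k
  rewrite tick-frame (suc v) 11 (c ,ℕ n ,ℕ i) k
        | π₁-, c (n ,ℕ i) | π₂-, c (n ,ℕ i) | π₁-, n i | π₂-, n i = refl

mutual
  -- The rest `k` of the stack is arbitrary, because subprograms run on top of frames that remember
  -- the pending work.
  machine-complete : ∀ c {n m} → no-oracle ⊢ c ∙ n ↓ m → ∀ k → (n ,ℕ encode c ,ℕ k) ⇝ (m ,ℕ k)
  machine-complete zero   {n} refl k = 1 , tick-frame n 0 0 k
  machine-complete succ   {n} refl k = 1 , tick-frame n 1 0 k
  machine-complete left   {n} refl k = 1 , trans (tick-frame n 2 0 k) (cong (_,ℕ k) (π₁-def n))
  machine-complete right  {n} refl k = 1 , trans (tick-frame n 3 0 k) (cong (_,ℕ k) (π₂-def n))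
  machine-complete oracle {n} refl k = 1 , tick-frame n 0 0 k
  machine-complete (pair c d) {n} (a , b , p , q , refl) k =
    ⇝-tick (tick-pair n (encode c) (encode d) k)
    (⇝-trans (machine-complete c p _)
    (⇝-tick (tick-pair₁ a (encode d) n k)
    (⇝-trans (machine-complete d q _)
    (1 , trans (tick-frame b 6 a k) (cong (_,ℕ k) (,ℕ-def a b))))))
  machine-complete (comp c d) {n} (_ , p , q) k =
    ⇝-tick (tick-comp n (encode c) (encode d) k)
    (⇝-trans (machine-complete d p _) (machine-complete c q k))
  machine-complete (prec c d) {n} {m} p k
    rewrite sym (π₁-def n) | sym (π₂-def n) =
    ⇝-tick (tick-prec n (encode c) (encode d) k)
    (⇝-trans (loop-complete c d (π₁ n) (π₂ n) (sym (+-identityʳ (π₂ n))) p k)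
    (1 , tick-loop-stop m (encode d) (π₁ n) (π₂ n) k))
  machine-complete (μ c) {n} {m} (p , q) k =
    ⇝-tick (tick-frame n 10 (encode c) k)
    (⇝-trans (seek-complete c n m q m ≤-refl k)
    (⇝-trans (machine-complete c (subst (no-oracle ⊢ c ∙_↓ 0) (sym (,ℕ-def n m)) p) _)
    (1 , tick-seek-stop (encode c) n m k)))

  -- The frame keeps the rounds done and the rounds left. Fixing only their sum `l` lets the
  -- induction follow the run upwards from round 0.
  loop-complete : ∀ c d a n {l j} → l ≡ n + j → ∀ {m} →
    PrimRec (no-oracle ⊢ c ∙_↓_) (no-oracle ⊢ d ∙_↓_) a n m → ∀ k →
    (a ,ℕ encode c ,ℕ loop (encode d) a 0 l ,ℕ k) ⇝ (m ,ℕ loop (encode d) a n j ,ℕ k)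
  loop-complete c d a zero            refl p k = machine-complete c p _
  loop-complete c d a (suc n) {j = j} l≡   (r , p , q) k =
    ⇝-trans (loop-complete c d a n (trans l≡ (sym (+-suc n j))) p k)
    (⇝-tick (tick-loop r (encode d) a n j k)
    (machine-complete d (subst (no-oracle ⊢ d ∙_↓ _) (sym packed) q) _))
    where
    packed : (a ,ℕ n ,ℕ r) ≡ ⟨ a , ⟨ n , r ⟩ ⟩
    packed = trans (,ℕ-def a (n ,ℕ r)) (cong ⟨ a ,_⟩ (,ℕ-def n r))

  seek-complete : ∀ c n m → (∀ i → i < m → ∃[ v ] (no-oracle ⊢ c ∙ ⟨ n , i ⟩ ↓ suc v)) →
    ∀ i → i ≤ m → ∀ k →
    ((n ,ℕ 0) ,ℕ encode c ,ℕ seek (encode c) n 0 ,ℕ k) ⇝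
    ((n ,ℕ i) ,ℕ encode c ,ℕ seek (encode c) n i ,ℕ k)
  seek-complete c n m q zero    i≤m k = ⇝-refl
  seek-complete c n m q (suc i) i<m k with q i i<m
  ... | v , p =
    ⇝-trans (seek-complete c n m q i (<⇒≤ i<m) k)
    (⇝-trans (machine-complete c (subst (no-oracle ⊢ c ∙_↓ suc v) (sym (,ℕ-def n i)) p) _)
    (1 , tick-seek v (encode c) n i k))

-- Running times and values of numbered programs.

tick-halted : ∀ s → tag s ≡ 0 → tick s ≡ s
tick-halted s eq rewrite eq = refl

fold-halted : ∀ s u → tag s ≡ 0 → fold s tick u ≡ s
fold-halted s zero    eq = refl
fold-halted s (suc u) eq = trans (cong tick (fold-halted s u eq)) (tick-halted s eq)

opaque
  state value flag : ℕ → ℕ → ℕ → ℕ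
  state e t n = fold (n ,ℕ e ,ℕ 0) tick t
  value e t n = π₁ (state e t n)
  flag  e t n = tag (state e t n)

Halts : ℕ → ℕ → ℕ → Set
Halts e t n = flag e t n ≡ 0

Computes : ℕ → (ℕ → ℕ) → Set
Computes e f = ∀ n → ∃[ t ] Halts e t n × value e t n ≡ f n

opaque
  unfolding state

  state-stable : ∀ {e t u n} → t ≤ u → Halts e t n → state e u n ≡ state e t n
  state-stable {e} {t} {u} {n} t≤u h = begin
    state e u n                         ≡⟨ cong (λ v → state e v n) (m∸n+n≡m t≤u) ⟨
    state e (u ∸ t + t) n               ≡⟨ fold-+ _ tick (u ∸ t) ⟩
    fold (state e t n) tick (u ∸ t)     ≡⟨ fold-halted _ (u ∸ t) h ⟩
    state e t n                         ∎
    where open ≡-Reasoning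

  Halts-mono : ∀ {e t u n} → t ≤ u → Halts e t n → Halts e u n
  Halts-mono {e} {t} t≤u h = trans (cong tag (state-stable {e} {t} t≤u h)) h

  value-unique : ∀ {e t u n} → Halts e t n → Halts e u n → value e t n ≡ value e u n
  value-unique {e} {t} {u} h h′ with ≤-total t u
  ... | inj₁ t≤u = cong π₁ (sym (state-stable {e} {t} {u} t≤u h))
  ... | inj₂ u≤t = cong π₁ (state-stable {e} {u} {t} u≤t h′)

  machine-computes : ∀ {f} ((c , _) : Computable f) → Computes (encode c) f
  machine-computes {f} (c , c↓f) n with machine-complete c (c↓f n) 0
  ... | t , eq = t , trans (cong tag eq) halted , trans (cong π₁ eq) (π₁-, (f n) 0)
    where
    halted : tag (f n ,ℕ 0) ≡ 0
    halted rewrite π₂-, (f n) 0 | π₁-0 = π₁-0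

  value-representable : Represented {3} λ { _ (e ∷ t ∷ n ∷ []) → value e t n }
  value-representable = represented-as (π₁ᵗ (foldᵗ tickᵗ #1 (#2 ,ᵗ #0 ,ᵗ nat 0))) λ { _ (e ∷ t ∷ n ∷ []) → refl }

  flag-representable : Represented {3} λ { _ (e ∷ t ∷ n ∷ []) → flag e t n }
  flag-representable = represented-as (tagᵗ (foldᵗ tickᵗ #1 (#2 ,ᵗ #0 ,ᵗ nat 0))) λ { _ (e ∷ t ∷ n ∷ []) → refl }

valueᵗ : ∀ {k} → Term k → Term k → Term k → Term k
valueᵗ e t n = fn _ value-representable (e ∷ t ∷ n ∷ [])

Haltsᶠ : ∀ {k} → Term k → Term k → Term k → Formula k
Haltsᶠ e t n = fn _ flag-representable (e ∷ t ∷ n ∷ []) ≐ nat 0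

monusᵗ : ∀ {k} → Term k → Term k → Term k
monusᵗ t s = fn (λ { _ (m ∷ n ∷ []) → m ∸ n })
  (represented-as (#0 ∸ᵗ #1) λ { α (m ∷ n ∷ []) → ∸ᵗ-correct #0 #1 α (m ∷ n ∷ []) })
  (t ∷ s ∷ [])

-- Maps on tuples and finite permutations.

mapTuple : (ℕ → ℕ) → ℕ → ℕ → ℕ
mapTuple g zero    w = 0
mapTuple g (suc k) w = g (π₁ w) ,ℕ mapTuple g k (π₂ w)

mapTuple-∘ : ∀ g h k w → mapTuple g k (mapTuple h k w) ≡ mapTuple (g ∘ h) k w
mapTuple-∘ g h zero    w = refl
mapTuple-∘ g h (suc k) w
  rewrite π₁-, (h (π₁ w)) (mapTuple h k (π₂ w)) | π₂-, (h (π₁ w)) (mapTuple h k (π₂ w))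
  = cong (g (h (π₁ w)) ,ℕ_) (mapTuple-∘ g h k (π₂ w))

mapTuple-cong : ∀ {g h} k w → (∀ v → v ≤ w → g v ≡ h v) → mapTuple g k w ≡ mapTuple h k w
mapTuple-cong zero    w eq = refl
mapTuple-cong (suc k) w eq = cong₂ _,ℕ_ (eq (π₁ w) (π₁≤ w))
  (mapTuple-cong k (π₂ w) (λ v v≤ → eq v (≤-trans v≤ (π₂≤ w))))

untuple-mapTuple : ∀ g k w → untuple k (mapTuple g k w) ≡ map g (untuple k w)
untuple-mapTuple g zero    w = refl
untuple-mapTuple g (suc k) w = cong₂ _∷_
  (trans (sym (π₁-def _)) (trans (π₁-, _ _) (cong g (π₁-def w))))
  (trans (cong (untuple k) (trans (sym (π₂-def _)) (π₂-, (g (π₁ w)) _)))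
    (trans (untuple-mapTuple g k (π₂ w)) (cong (map g ∘ untuple k) (π₂-def w))))

tuple : ∀ {k} → Vec ℕ k → ℕ
tuple []      = 0
tuple (v ∷ u) = v ,ℕ tuple u

untuple-tuple : ∀ {k} (u : Vec ℕ k) → untuple k (tuple u) ≡ u
untuple-tuple []      = refl
untuple-tuple (v ∷ u) = cong₂ _∷_
  (trans (sym (π₁-def _)) (π₁-, v (tuple u)))
  (trans (cong (untuple _) (trans (sym (π₂-def _)) (π₂-, v (tuple u)))) (untuple-tuple u))

vars : ∀ s m → Vec (Term (s + m)) m
vars s m = tabulate (var ∘ (s ↑ʳ_))

evals-tabulate : ∀ {k m} (f : Fin m → Fin k) α ρ →
  evals (tabulate (var ∘ f)) α ρ ≡ tabulate (lookup ρ ∘ f)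
evals-tabulate {m = zero}  f α ρ = refl
evals-tabulate {m = suc m} f α ρ = cong (lookup ρ (f zero) ∷_) (evals-tabulate (f ∘ suc) α ρ)

mapTuple-representable : ∀ {m} (g : Term (suc m)) → Represented {2 + m}
  λ { α (k ∷ w ∷ ρ) → mapTuple (λ v → eval g α (v ∷ ρ)) k w }
mapTuple-representable {m} g = represented-as
  (recᵗ (nat 0) (call g (π₁ᵗ suffix ∷ vars 4 m) ,ᵗ #0) #0)
  λ { α (k ∷ w ∷ ρ) →
      trans (correct α k w ρ k ≤-refl)
        (cong (λ n → mapTuple (λ v → eval g α (v ∷ ρ)) k (fold w π₂ n)) (n∸n≡0 k)) }
  where
  -- Tuples are built from the last entry; the suffix starts at the current one.
  suffix : Term (4 + m)
  suffix = foldᵗ (π₂ᵗ #0) (monusᵗ #2 (sucᵗ #1)) #3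

  correct : ∀ α k w ρ i → i ≤ k →
    primRec 0 (λ i r → eval (call g (π₁ᵗ suffix ∷ vars 4 m) ,ᵗ #0) α (r ∷ i ∷ k ∷ w ∷ ρ)) i
    ≡ mapTuple (λ v → eval g α (v ∷ ρ)) i (fold w π₂ (k ∸ i))
  correct α k w ρ zero    i≤k = refl
  correct α k w ρ (suc i) i<k = cong₂ _,ℕ_
    (cong (λ σ → eval g α (π₁ (fold w π₂ (k ∸ suc i)) ∷ σ))
      (trans (evals-tabulate (4 ↑ʳ_) α _) (tabulate∘lookup ρ)))
    (trans (correct α k w ρ i (<⇒≤ i<k))
      (cong (λ n → mapTuple (λ v → eval g α (v ∷ ρ)) i (fold w π₂ n)) (+-∸-assoc 1 i<k)))

swap : ℕ → ℕ → ℕ → ℕ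
swap c d n with n ≟ c | n ≟ d
... | yes _ | _     = d
... | no _  | yes _ = c
... | no _  | no _  = n

swap-fst : ∀ c d → swap c d c ≡ d
swap-fst c d with c ≟ c | c ≟ d
... | yes _  | _ = refl
... | no c≢c | _ = contradiction refl c≢c

swap-other : ∀ {c d n} → n ≢ c → n ≢ d → swap c d n ≡ n
swap-other {c} {d} {n} n≢c n≢d with n ≟ c | n ≟ d
... | yes n≡c | _       = contradiction n≡c n≢c
... | no _    | yes n≡d = contradiction n≡d n≢d
... | no _    | no _    = refl

swap-snd : ∀ c d → swap c d d ≡ c
swap-snd c d with d ≟ c | d ≟ d
... | yes d≡c | _      = d≡c
... | no _    | yes _  = refl
... | no _    | no d≢d = contradiction refl d≢d

swap-involutive : ∀ c d n → swap c d (swap c d n) ≡ n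
swap-involutive c d n with n ≟ c | n ≟ d
... | yes n≡c | _       = trans (swap-snd c d) (sym n≡c)
... | no _    | yes n≡d = trans (swap-fst c d) (sym n≡d)
... | no n≢c  | no n≢d  = swap-other n≢c n≢d

applySwaps : ℕ → ℕ → ℕ → ℕ
applySwaps zero    l n = n
applySwaps (suc k) l n = applySwaps k (π₂ l) (swap (π₁ (π₁ l)) (π₂ (π₁ l)) n)

applySwaps⁻¹ : ℕ → ℕ → ℕ → ℕ
applySwaps⁻¹ zero    l n = n
applySwaps⁻¹ (suc k) l n = swap (π₁ (π₁ l)) (π₂ (π₁ l)) (applySwaps⁻¹ k (π₂ l) n)

applySwaps-inverseˡ : ∀ k l n → applySwaps k l (applySwaps⁻¹ k l n) ≡ n
applySwaps-inverseˡ zero    l n = refl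
applySwaps-inverseˡ (suc k) l n =
  trans (cong (applySwaps k (π₂ l)) (swap-involutive _ _ _)) (applySwaps-inverseˡ k (π₂ l) n)

applySwaps-inverseʳ : ∀ k l n → applySwaps⁻¹ k l (applySwaps k l n) ≡ n
applySwaps-inverseʳ zero    l n = refl
applySwaps-inverseʳ (suc k) l n =
  trans (cong (swap _ _) (applySwaps-inverseʳ k (π₂ l) _)) (swap-involutive _ _ n)

-- Every finite product of transpositions of ℕ is some swaps q, where q codes the
-- number of factors together with the list of factors.

swaps swaps⁻¹ : ℕ → ℕ → ℕ
swaps   q = applySwaps   (π₁ q) (π₂ q)
swaps⁻¹ q = applySwaps⁻¹ (π₁ q) (π₂ q)

swaps-swaps⁻¹ : ∀ q n → swaps q (swaps⁻¹ q n) ≡ n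
swaps-swaps⁻¹ q = applySwaps-inverseˡ (π₁ q) (π₂ q)

swaps-bijective : ∀ q → Bijective _≡_ _≡_ (swaps q)
swaps-bijective q = inverseᵇ⇒bijective {f⁻¹ = swaps⁻¹ q}
  ((λ { refl → swaps-swaps⁻¹ q _ }) , (λ { refl → applySwaps-inverseʳ (π₁ q) (π₂ q) _ }))

swapᵗ : Term 3
swapᵗ = ifzᵗ (χ (#2 ≐ #0)) #1 (ifzᵗ (χ (#2 ≐ #1)) #0 #2)

ifz-χ-yes : ∀ {k} (φ : Formula k) α ρ {a b} → ⟦ φ ⟧ α ρ → ifz (eval (χ φ) α ρ) a b ≡ a
ifz-χ-yes φ α ρ p rewrite χ-complete φ p = refl

ifz-χ-no : ∀ {k} (φ : Formula k) α ρ {a b} → ¬ ⟦ φ ⟧ α ρ → ifz (eval (χ φ) α ρ) a b ≡ b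
ifz-χ-no φ α ρ ¬p with eval (χ φ) α ρ in eq
... | zero  = contradiction (χ-sound φ eq) ¬p
... | suc _ = refl

swapᵗ-correct : ∀ α c d n → eval swapᵗ α (c ∷ d ∷ n ∷ []) ≡ swap c d n
swapᵗ-correct α c d n with n ≟ c | n ≟ d
... | yes n≡c | _       = ifz-χ-yes (#2 ≐ #0) α (c ∷ d ∷ n ∷ []) n≡c
... | no n≢c  | yes n≡d = trans (ifz-χ-no (#2 ≐ #0) α (c ∷ d ∷ n ∷ []) n≢c) (ifz-χ-yes (#2 ≐ #1) α (c ∷ d ∷ n ∷ []) n≡d)
... | no n≢c  | no n≢d  = trans (ifz-χ-no (#2 ≐ #0) α (c ∷ d ∷ n ∷ []) n≢c) (ifz-χ-no (#2 ≐ #1) α (c ∷ d ∷ n ∷ []) n≢d)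

swapsᵗ : ∀ {k} → Term k → Term k → Term k
swapsᵗ q n = fn (λ { _ (q ∷ n ∷ []) → swaps q n })
  (represented-as (π₂ᵗ (foldᵗ stepᵗ (π₁ᵗ #0) (π₂ᵗ #0 ,ᵗ #1)))
    λ { α (q ∷ n ∷ []) → trans (cong π₂ (iterate-is-fold _ _ (π₁ q))) (correct α (π₁ q) (π₂ q) n) })
  (q ∷ n ∷ [])
  where
  stepᵗ : Term 1
  stepᵗ = π₂ᵗ (π₁ᵗ #0) ,ᵗ call swapᵗ (π₁ᵗ (π₁ᵗ (π₁ᵗ #0)) ∷ π₂ᵗ (π₁ᵗ (π₁ᵗ #0)) ∷ π₂ᵗ #0 ∷ [])

  correct : ∀ α k l n → π₂ (iterate (λ s → eval stepᵗ α (s ∷ [])) (l ,ℕ n) k) ≡ applySwaps k l n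
  correct α zero    l n = π₂-, l n
  correct α (suc k) l n
    rewrite π₁-, l n | π₂-, l n | swapᵗ-correct α (π₁ (π₁ l)) (π₂ (π₁ l)) n
    = correct α k (π₂ l) (swap (π₁ (π₁ l)) (π₂ (π₁ l)) n)

-- Each new point `K` is first exchanged with the preimage of its target under the permutation found
-- so far. By injectivity this preimage is no earlier point of `P`, so earlier values survive.
swaps-extend : ∀ {P : ℕ → Set} → (∀ n → Dec (P n)) → (G : ℕ → ℕ) →
  (∀ {m n} → P m → P n → G m ≡ G n → m ≡ n) →
  ∀ K → ∃[ q ] (∀ n → n < K → P n → swaps q n ≡ G n)
swaps-extend P? G inj zero = 0 , λ _ ()
swaps-extend P? G inj (suc K) with swaps-extend P? G inj K | P? K
... | q , agrees | no ¬PK = q , λ n n<1+K Pn →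
  agrees n (≤∧≢⇒< (s≤s⁻¹ n<1+K) (λ { refl → ¬PK Pn })) Pn
... | q , agrees | yes PK = q′ , extended
  where
  c q′ : ℕ
  c  = swaps⁻¹ q (G K)
  q′ = suc (π₁ q) ,ℕ (K ,ℕ c) ,ℕ π₂ q

  swaps-q′ : ∀ n → swaps q′ n ≡ swaps q (swap K c n)
  swaps-q′ n
    rewrite π₁-, (suc (π₁ q)) ((K ,ℕ c) ,ℕ π₂ q) | π₂-, (suc (π₁ q)) ((K ,ℕ c) ,ℕ π₂ q)
          | π₁-, (K ,ℕ c) (π₂ q) | π₂-, (K ,ℕ c) (π₂ q) | π₁-, K c | π₂-, K c = refl

  extended : ∀ n → n < suc K → _ → swaps q′ n ≡ G n
  extended n n<1+K Pn with m≤n⇒m<n∨m≡n (s≤s⁻¹ n<1+K)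
  ... | inj₂ refl = trans (swaps-q′ K) (trans (cong (swaps q) (swap-fst K c)) (swaps-swaps⁻¹ q (G K)))
  ... | inj₁ n<K = trans (swaps-q′ n) (trans (cong (swaps q) (swap-other (<⇒≢ n<K) n≢c)) (agrees n n<K Pn))
    where
    n≢c : n ≢ c
    n≢c refl = <⇒≢ n<K (inj Pn PK (trans (sym (agrees n n<K Pn)) (swaps-swaps⁻¹ q (G K))))

-- Computable functions.

term-computable : (t : Term 1) → Computable (λ n → eval t no-oracle (n ∷ []))
term-computable t =
  comp (compile t) (pair zero (pair left right)) ,
  λ n → _ , (_ , _ , refl , (_ , _ , refl , refl , refl) , trans (,ℕ-def 0 n) (cong ⟨ 0 ,_⟩ (sym (⟨unpair⟩ n)))) ,
        compile-correct t no-oracle (n ∷ [])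

id-computable : Computable id
id-computable = term-computable #0

Computable-∘ : ∀ {f g} → Computable f → Computable g → Computable (f ∘ g)
Computable-∘ (c , p) (d , q) = comp c d , λ n → _ , q n , p _

inverse-computable : ∀ {f} → Computable f → Bijective _≡_ _≡_ f →
  ∃[ g ] Computable g × (∀ n → f (g n) ≡ n)
inverse-computable {f} fc (_ , surj) =
  computable-search (unary fc #0 ≐ #1) λ n → proj₁ (surj n) , proj₂ (surj n) refl

-- Tests and the Π⁰₂ condition behind an edge.

module Relativised {a : ℕ → ℕ} (a-computable : Computable a) where

  -- The action of a map on bit positions: the bits of x ∘ g are the bits of x at these positions,
  -- see `toCantor-pullBack`.
  pullIndex : (ℕ → ℕ) → ℕ → ℕ
  pullIndex g n = π₁ n ,ℕ mapTuple g (a (π₁ n)) (π₂ n)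

  pullIndex-∘ : ∀ g h n → pullIndex g (pullIndex h n) ≡ pullIndex (g ∘ h) n
  pullIndex-∘ g h n
    rewrite π₁-, (π₁ n) (mapTuple h (a (π₁ n)) (π₂ n)) | π₂-, (π₁ n) (mapTuple h (a (π₁ n)) (π₂ n))
    = cong (π₁ n ,ℕ_) (mapTuple-∘ g h (a (π₁ n)) (π₂ n))

  -- An entry of a tuple never exceeds its code. Each bit thus depends on finitely many values of
  -- the map, with a bound known in advance.
  pullIndex-cong : ∀ {g h} n → (∀ v → v ≤ n → g v ≡ h v) → pullIndex g n ≡ pullIndex h n
  pullIndex-cong n eq = cong (π₁ n ,ℕ_)
    (mapTuple-cong (a (π₁ n)) (π₂ n) λ v v≤ → eq v (≤-trans v≤ (π₂≤ n)))

  pull : (ℕ → ℕ) → (ℕ → ℕ) → ℕ → ℕ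
  pull g X n = X (pullIndex g n)

  -- In j = ⟨ p , e ⟩ the pattern p = ⟨ i , w ⟩ stands for a relation and a tuple.
  -- The test compares the relation on two copies of w; block (j , b) consists of
  -- the numbers ⟨ ⟨ j , b ⟩ , v ⟩, so copies in different blocks are disjoint.
  Test : (ℕ → ℕ) → ℕ → Set
  Test X j = pull ((j ,ℕ 0) ,ℕ_) X (π₁ j) ≢ pull ((j ,ℕ 1) ,ℕ_) X (π₁ j)

  First : (ℕ → ℕ) → ℕ → Set
  First X j = Test X j × (∀ i → i < j → ¬ Test X i)

  First-unique : ∀ X {i j} → First X i → First X j → i ≡ j
  First-unique X {i} {j} (Ti , ¬T<i) (Tj , ¬T<j) with <-cmp i j
  ... | tri< i<j _ _ = contradiction Ti (¬T<j i i<j)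
  ... | tri≈ _ i≡j _ = i≡j
  ... | tri> _ _ j<i = contradiction Tj (¬T<i j j<i)

  Test-cong : ∀ X Y j →
    (∀ b → b < 2 → pull ((j ,ℕ b) ,ℕ_) X (π₁ j) ≡ pull ((j ,ℕ b) ,ℕ_) Y (π₁ j)) → Test X j → Test Y j
  Test-cong X Y j eq T Yeq = T (trans (eq 0 (s≤s z≤n)) (trans Yeq (sym (eq 1 (s≤s (s≤s z≤n))))))

  First-cong : ∀ X Y j →
    (∀ i → i ≤ j → ∀ b → b < 2 → pull ((i ,ℕ b) ,ℕ_) X (π₁ i) ≡ pull ((i ,ℕ b) ,ℕ_) Y (π₁ i)) →
    First X j → First Y j
  First-cong X Y j eq (T , ¬T<) = Test-cong X Y j (eq j ≤-refl) T ,
    λ i i<j Ti → ¬T< i i<j (Test-cong Y X i (λ b b<2 → sym (eq i (<⇒≤ i<j) b b<2)) Ti)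

  First-≗ : ∀ X Y j → (∀ n → X n ≡ Y n) → First X j → First Y j
  First-≗ X Y j eq = First-cong X Y j λ i _ b _ → eq (pullIndex ((i ,ℕ b) ,ℕ_) (π₁ i))

  First-pull-≗ : ∀ g X Y j → (∀ n → X n ≡ Y n) → First (pull g X) j → First (pull g Y) j
  First-pull-≗ g X Y j eq = First-≗ (pull g X) (pull g Y) j (λ n → eq (pullIndex g n))

  -- A finite region that decides `First` at j: test i ≤ j reads its blocks only at v ≤ π₁ i ≤ j.
  AgreeOnBlocks : ℕ → (g h : ℕ → ℕ) → Set
  AgreeOnBlocks j g h = ∀ i → i < suc j → ∀ b → b < 2 → ∀ v → v < suc j →
    g ((i ,ℕ b) ,ℕ v) ≡ h ((i ,ℕ b) ,ℕ v)

  pull-column-cong : ∀ {g h} X i c → (∀ v → v ≤ i → g (c ,ℕ v) ≡ h (c ,ℕ v)) →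
    pull (c ,ℕ_) (pull g X) (π₁ i) ≡ pull (c ,ℕ_) (pull h X) (π₁ i)
  pull-column-cong {g} {h} X i c eq = cong X (begin
    pullIndex g (pullIndex (c ,ℕ_) (π₁ i)) ≡⟨ pullIndex-∘ g (c ,ℕ_) (π₁ i) ⟩
    pullIndex (g ∘ (c ,ℕ_)) (π₁ i)         ≡⟨ pullIndex-cong (π₁ i) (λ v v≤ → eq v (≤-trans v≤ (π₁≤ i))) ⟩
    pullIndex (h ∘ (c ,ℕ_)) (π₁ i)         ≡⟨ pullIndex-∘ h (c ,ℕ_) (π₁ i) ⟨
    pullIndex h (pullIndex (c ,ℕ_) (π₁ i)) ∎)
    where open ≡-Reasoning

  First-pull-cong : ∀ {g h} X j → AgreeOnBlocks j g h → First (pull g X) j → First (pull h X) j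
  First-pull-cong {g} {h} X j eq = First-cong (pull g X) (pull h X) j λ i i≤j b b<2 →
    pull-column-cong {g} {h} X i (i ,ℕ b) λ v v≤i → eq i (s≤s i≤j) b b<2 v (s≤s (≤-trans v≤i i≤j))

  approx : ℕ → ℕ → ℕ → ℕ → ℕ
  approx e t q v = value e t (swaps q v)

  HaltsOnBlocks : ℕ → ℕ → ℕ → ℕ → Set
  HaltsOnBlocks e t q j = ∀ i → i < suc j → ∀ b → b < 2 → ∀ v → v < suc j →
    Halts e t (swaps q ((i ,ℕ b) ,ℕ v))

  -- The part of the witness at n that has to be checked.  Here j is determined by
  -- Z, and q by Y, j and the function computed by e.  All n therefore share one j
  -- and one q, although these are quantified after n to obtain a Π⁰₂ condition.
  record Approximation (Y Z : ℕ → ℕ) (e j q t b n : ℕ) : Set where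
    constructor approximation
    field
      first      : First Z j
      on-blocks  : ∀ r → r < suc q → HaltsOnBlocks e t r j
      reached    : First (pull (approx e t q) Y) j
      least      : ∀ r → r < q → ¬ First (pull (approx e t r) Y) j
      total      : ∀ v → v < suc n → Halts e t v × Halts e t (swaps q v)
      halts      : Halts e t b
      surjective : value e t b ≡ n
      injective  : ¬ (value e t (π₁ n) ≡ value e t (π₂ n)) ⊎ π₁ n ≡ π₂ n
      pulled     : Z n ≡ pull (approx e t q) Y n

  open Approximation

  Approximated : (Y Z : ℕ → ℕ) → (ℕ → ℕ) → Set
  Approximated Y Z prog =
    ∀ n → ∃[ j ] ∃[ q ] ∃[ t ] ∃[ b ] Approximation Y Z (prog j) j q t b n

  Approximated-≗ : ∀ Y Y′ Z Z′ {prog} → (∀ n → Y n ≡ Y′ n) → (∀ n → Z n ≡ Z′ n) →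
    Approximated Y Z prog → Approximated Y′ Z′ prog
  Approximated-≗ Y Y′ Z Z′ {prog} Y≗ Z≗ A n with A n
  ... | j , q , t , b , ap = j , q , t , b , record
    { first      = First-≗ Z Z′ j Z≗ (first ap)
    ; on-blocks  = on-blocks ap
    ; reached    = First-pull-≗ (approx (prog j) t q) Y Y′ j Y≗ (reached ap)
    ; least      = λ r r<q F → least ap r r<q (First-pull-≗ (approx (prog j) t r) Y′ Y j (λ m → sym (Y≗ m)) F)
    ; total      = total ap
    ; halts      = halts ap
    ; surjective = surjective ap
    ; injective  = injective ap
    ; pulled     = trans (sym (Z≗ n)) (trans (pulled ap) (Y≗ (pullIndex (approx (prog j) t q) n)))
    }

  Pulled : (Y Z : ℕ → ℕ) → (ℕ → ℕ) → ℕ → ℕ → Set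
  Pulled Y Z f j q = First Z j × First (pull (f ∘ swaps q) Y) j ×
    (∀ r → r < q → ¬ First (pull (f ∘ swaps r) Y) j) × (∀ n → Z n ≡ pull (f ∘ swaps q) Y n)

  module _ {Y Z : ℕ → ℕ} {prog : ℕ → ℕ} (A : Approximated Y Z prog) where

    private
      j e : ℕ
      j = proj₁ (A 0)
      e = prog j

      entry : ∀ n → ∃[ q ] ∃[ t ] ∃[ b ] Approximation Y Z e j q t b n
      entry n with A n
      ... | i , q , t , b , ap with First-unique Z (first ap) (first (proj₂ (proj₂ (proj₂ (proj₂ (A 0))))))
      ...   | refl = q , t , b , ap

      Q T B : ℕ → ℕ
      Q n = proj₁ (entry n)
      T n = proj₁ (proj₂ (entry n))
      B n = proj₁ (proj₂ (proj₂ (entry n)))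

      ap : ∀ n → Approximation Y Z e j (Q n) (T n) (B n) n
      ap n = proj₂ (proj₂ (proj₂ (entry n)))

      time : ∃[ h ] Computable h × (∀ n → Halts e (h n) n)
      time = computable-search (Haltsᶠ (nat e) #0 #1) λ n → T n , proj₁ (total (ap n) n ≤-refl)

      f : ℕ → ℕ
      f n = value e (proj₁ time n) n

      value-f : ∀ {t v} → Halts e t v → value e t v ≡ f v
      value-f {t} {v} h = value-unique {e} {t} {proj₁ time v} h (proj₂ (proj₂ time) v)

      -- The pair x, y is checked at the number that codes it, which also bounds both and so
      -- guarantees halting there.
      f-injective : ∀ {x y} → f x ≡ f y → x ≡ y
      f-injective {x} {y} fx≡fy = [ (λ ≢ → contradiction equal ≢) , unpacked ]′ (injective (ap (x ,ℕ y)))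
        where
        t : ℕ
        t = T (x ,ℕ y)

        unpacked : π₁ (x ,ℕ y) ≡ π₂ (x ,ℕ y) → x ≡ y
        unpacked eq = trans (sym (π₁-, x y)) (trans eq (π₂-, x y))

        equal : value e t (π₁ (x ,ℕ y)) ≡ value e t (π₂ (x ,ℕ y))
        equal = begin
          value e t (π₁ (x ,ℕ y)) ≡⟨ cong (value e t) (π₁-, x y) ⟩
          value e t x             ≡⟨ value-f {t} (proj₁ (total (ap (x ,ℕ y)) x (s≤s (≤-,₁ x y)))) ⟩
          f x                     ≡⟨ fx≡fy ⟩
          f y                     ≡⟨ value-f {t} (proj₁ (total (ap (x ,ℕ y)) y (s≤s (≤-,₂ x y)))) ⟨
          value e t y             ≡⟨ cong (value e t) (π₂-, x y) ⟨
          value e t (π₂ (x ,ℕ y)) ∎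
          where open ≡-Reasoning

      f-surjective : ∀ n → ∃[ b ] f b ≡ n
      f-surjective n = B n , trans (sym (value-f {T n} (halts (ap n)))) (surjective (ap n))

      approx-f : ∀ n r → r < suc (Q n) → AgreeOnBlocks j (approx e (T n) r) (f ∘ swaps r)
      approx-f n r r≤q i i≤j b b<2 v v≤j = value-f {T n} (on-blocks (ap n) r r≤q i i≤j b b<2 v v≤j)

      f-approx : ∀ n r → r < suc (Q n) → AgreeOnBlocks j (f ∘ swaps r) (approx e (T n) r)
      f-approx n r r≤q i i≤j b b<2 v v≤j = sym (approx-f n r r≤q i i≤j b b<2 v v≤j)

      f-reached : ∀ n → First (pull (f ∘ swaps (Q n)) Y) j
      f-reached n = First-pull-cong Y j (approx-f n (Q n) ≤-refl) (reached (ap n))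

      -- This is why `on-blocks` covers all r up to q: a failure of the approximation is a failure
      -- for `f` only where the program has halted.
      f-least : ∀ n r → r < Q n → ¬ First (pull (f ∘ swaps r) Y) j
      f-least n r r<q F = least (ap n) r r<q (First-pull-cong Y j (f-approx n r (m≤n⇒m≤1+n r<q)) F)

      -- Once stated for `f` in place of its approximations, the property that makes `Q n` least no
      -- longer mentions n.
      Q-constant : ∀ n → Q n ≡ Q 0
      Q-constant n with <-cmp (Q n) (Q 0)
      ... | tri< Qn<Q0 _ _ = contradiction (f-reached n) (f-least 0 (Q n) Qn<Q0)
      ... | tri≈ _ eq _    = eq
      ... | tri> _ _ Q0<Qn = contradiction (f-reached 0) (f-least n (Q 0) Q0<Qn)

      f-pulled : ∀ n → Z n ≡ pull (f ∘ swaps (Q 0)) Y n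
      f-pulled n = trans (pulled (ap n)) (cong Y (trans
        (pullIndex-cong n λ v v≤n → value-f {T n} (proj₂ (total (ap n) v (s≤s v≤n))))
        (cong (λ q → pullIndex (f ∘ swaps q) n) (Q-constant n))))

    approximated-first : ∃[ j ] First Z j
    approximated-first = j , first (ap 0)

    approximated-sound : ∃[ f ] Computable f × Bijective _≡_ _≡_ f ×
      ∃[ q ] (∀ n → Z n ≡ pull (f ∘ swaps q) Y n)
    approximated-sound =
      f , term-computable (valueᵗ (nat e) (unary (proj₁ (proj₂ time)) #0) #0) ,
      (f-injective , strictlySurjective⇒surjective f-surjective) ,
      Q 0 , f-pulled

  eventually-all : ∀ {P : ℕ → ℕ → Set} → (∀ {v t u} → t ≤ u → P t v → P u v) →
    (∀ v → ∃[ t ] P t v) → ∀ N → ∃[ t ] (∀ v → v < N → P t v)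
  eventually-all mono eventually zero    = 0 , λ _ ()
  eventually-all {P} mono eventually (suc N) with eventually-all {P} mono eventually N | eventually N
  ... | t , all | u , p = t ⊔ u , λ v v<1+N → helper v (m≤n⇒m<n∨m≡n (s≤s⁻¹ v<1+N))
    where
    helper : ∀ v → v < N ⊎ v ≡ N → P (t ⊔ u) v
    helper v (inj₁ v<N)  = mono (m≤m⊔n t u) (all v v<N)
    helper v (inj₂ refl) = mono (m≤n⊔m t u) p

  approximated-complete : ∀ {Y Z prog f j q} → Computes (prog j) f → Bijective _≡_ _≡_ f →
    Pulled Y Z f j q → Approximated Y Z prog
  approximated-complete {Y} {Z} {prog} {f} {j} {q} computes (inj , surj) (firstZ , reach , leastq , pull≡) n =
    j , q , t , b , record
      { first      = firstZ
      ; on-blocks  = blocks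
      ; reached    = First-pull-cong Y j (λ i i≤j c c<2 v v≤j → sym (value-f (blocks q ≤-refl i i≤j c c<2 v v≤j))) reach
      ; least      = λ r r<q F → leastq r r<q (First-pull-cong Y j
                       (λ i i≤j c c<2 v v≤j → value-f (blocks r (m≤n⇒m≤1+n r<q) i i≤j c c<2 v v≤j)) F)
      ; total      = λ v v≤n → tot v (s≤s⁻¹ v≤n)
      ; halts      = halts-b
      ; surjective = trans (value-f halts-b) (proj₂ (surj n) refl)
      ; injective  = inject
      ; pulled     = trans (pull≡ n) (cong Y (pullIndex-cong n λ v v≤n → sym (value-f (proj₂ (tot v v≤n)))))
      }
    where
    e b M : ℕ
    e = prog j
    b = proj₁ (surj n)
    -- Bounds `b` and every pair (r , x) with r ≤ q and x in a block, as well as (q , v) with v ≤ n;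
    -- hence a single running time serves all fields.
    M = (q ,ℕ (((j ,ℕ 1) ,ℕ j) + n)) + b

    P : ℕ → ℕ → Set
    P t x = Halts e t x × Halts e t (swaps (π₁ x) (π₂ x))

    P-mono : ∀ {x t u} → t ≤ u → P t x → P u x
    P-mono {x} {t} {u} t≤u (h , h′) = Halts-mono {e} {t} {u} t≤u h , Halts-mono {e} {t} {u} t≤u h′

    P-eventually : ∀ x → ∃[ t ] P t x
    P-eventually x with computes x | computes (swaps (π₁ x) (π₂ x))
    ... | t , h , _ | u , h′ , _ =
      t ⊔ u , Halts-mono {e} {t} (m≤m⊔n t u) h , Halts-mono {e} {u} (m≤n⊔m t u) h′

    bounded : ∃[ t ] (∀ x → x < suc M → P t x)
    bounded = eventually-all {P} P-mono P-eventually (suc M)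

    t : ℕ
    t = proj₁ bounded

    value-f : ∀ {v} → Halts e t v → value e t v ≡ f v
    value-f {v} h with computes v
    ... | u , h′ , eq = trans (value-unique {e} {t} {u} h h′) eq

    swaps-halt : ∀ r x → (r ,ℕ x) ≤ M → Halts e t (swaps r x)
    swaps-halt r x ≤M =
      subst₂ (λ r x → Halts e t (swaps r x)) (π₁-, r x) (π₂-, r x) (proj₂ (proj₂ bounded (r ,ℕ x) (s≤s ≤M)))

    blocks : ∀ r → r < suc q → HaltsOnBlocks e t r j
    blocks r r≤q i i≤j c c<2 v v≤j = swaps-halt r _
      (≤-trans (,ℕ-mono (s≤s⁻¹ r≤q)
          (≤-trans (,ℕ-mono (,ℕ-mono (s≤s⁻¹ i≤j) (s≤s⁻¹ c<2)) (s≤s⁻¹ v≤j)) (m≤m+n _ n)))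
        (m≤m+n _ b))

    tot : ∀ v → v ≤ n → Halts e t v × Halts e t (swaps q v)
    tot v v≤n = proj₁ (proj₂ bounded v (s≤s (≤-trans (≤-,₂ q v) qv≤M))) , swaps-halt q v qv≤M
      where
      qv≤M : (q ,ℕ v) ≤ M
      qv≤M = ≤-trans (,ℕ-mono ≤-refl (≤-trans v≤n (m≤n+m n _))) (m≤m+n _ b)

    halts-b : Halts e t b
    halts-b = proj₁ (proj₂ bounded b (s≤s (m≤n+m b _)))

    inject : ¬ (value e t (π₁ n) ≡ value e t (π₂ n)) ⊎ π₁ n ≡ π₂ n
    inject with π₁ n ≟ π₂ n
    ... | yes eq = inj₂ eq
    ... | no neq = inj₁ λ eq → neq (inj (trans (sym (value-f (proj₁ (tot _ (π₁≤ n)))))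
                     (trans eq (value-f (proj₁ (tot _ (π₂≤ n)))))))

  -- The condition as a formula.

  pullIndexᵗ : ∀ {k m} → Term (suc m) → Vec (Term k) m → Term k → Term k
  pullIndexᵗ g ps n =
    π₁ᵗ n ,ᵗ fn _ (mapTuple-representable g) (unary a-computable (π₁ᵗ n) ∷ π₂ᵗ n ∷ ps)

  columnᵗ : ∀ {m} → Term (suc m) → ℕ → Term (suc m)
  columnᵗ {m} r b = call r (pullIndexᵗ (#1 ,ᵗ #0) ((#0 ,ᵗ nat b) ∷ []) (π₁ᵗ #0) ∷ vars 1 m)

  testᶠ firstᶠ : ∀ {m} → Term (suc m) → Formula (suc m)
  testᶠ r = ¬ᶠ (columnᵗ r 0 ≐ columnᵗ r 1)
  firstᶠ {m} r = testᶠ r ∧ᶠ all< #0 ((¬ᶠ testᶠ r) at (#0 ∷ vars 2 m))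

  readᵗ : ℕ → Term 1
  readᵗ z = askᵗ (nat z ,ᵗ #0)

  pulledᵗ : ℕ → Term 4
  pulledᵗ y = askᵗ (nat y ,ᵗ pullIndexᵗ (valueᵗ #1 #2 (swapsᵗ #3 #0)) (#1 ∷ #2 ∷ #3 ∷ []) #0)

  read : Cantor → ℕ → ℕ → ℕ
  read α z n = bit (α (z ,ℕ n))

  haltsOnBlocksᶠ : Formula 4
  haltsOnBlocksᶠ =
    all< (sucᵗ #3) (all< (nat 2) (all< (sucᵗ #5) (Haltsᶠ #3 #4 (swapsᵗ #5 ((#2 ,ᵗ #1) ,ᵗ #0)))))

  approximationᶠ : (y z : ℕ) → Formula 6
  approximationᶠ y z =
    (firstᶠ (readᵗ z) at (j ∷ [])) ∧ᶠ
    all< (sucᵗ q) (haltsOnBlocksᶠ at (#1 ∷ #4 ∷ #0 ∷ #2 ∷ [])) ∧ᶠ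
    (firstᶠ (pulledᵗ y) at (j ∷ e ∷ t ∷ q ∷ [])) ∧ᶠ
    all< q (¬ᶠ (firstᶠ (pulledᵗ y) at (#2 ∷ #1 ∷ #4 ∷ #0 ∷ []))) ∧ᶠ
    all< (sucᵗ n) (Haltsᶠ #1 #4 #0 ∧ᶠ Haltsᶠ #1 #4 (swapsᵗ #3 #0)) ∧ᶠ
    Haltsᶠ e t b ∧ᶠ
    valueᵗ e t b ≐ n ∧ᶠ
    (¬ᶠ (valueᵗ e t (π₁ᵗ n) ≐ valueᵗ e t (π₂ᵗ n)) ∨ᶠ π₁ᵗ n ≐ π₂ᵗ n) ∧ᶠ
    call (readᵗ z) (n ∷ []) ≐ call (pulledᵗ y) (n ∷ e ∷ t ∷ q ∷ [])
    where
    e j q t b n : Term 6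
    e = #0
    j = #1
    q = #2
    t = #3
    b = #4
    n = #5

  -- The meaning of the formula unfolds to the fields of the record, since `fn` evaluates to the
  -- function that it carries.
  ⟦approximationᶠ⟧ : ∀ y z α e j q t b n →
    ⟦ approximationᶠ y z ⟧ α (e ∷ j ∷ q ∷ t ∷ b ∷ n ∷ []) ⇔
    Approximation (read α y) (read α z) e j q t b n
  ⟦approximationᶠ⟧ y z α e j q t b n = mk⇔
    (λ (a , b , c , d , e , f , g , h , i) → approximation a b c d e f g h i)
    (λ (approximation a b c d e f g h i) → a , b , c , d , e , f , g , h , i)

  Π₂ : Formula 2 → Cantor → Set
  Π₂ φ α = ∀ n → ∃[ m ] ⟦ φ ⟧ α (m ∷ n ∷ [])

  opaque
    approximatedᶠ : (y z : ℕ) → Term 1 → Formula 2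
    approximatedᶠ y z prog =
      approximationᶠ y z at (call prog (j ∷ []) ∷ j ∷ π₁ᵗ (π₂ᵗ #0) ∷ π₁ᵗ tb ∷ π₂ᵗ tb ∷ #1 ∷ [])
      where
      j tb : Term 2
      j  = π₁ᵗ #0
      tb = π₂ᵗ (π₂ᵗ #0)

    ⟦approximatedᶠ⟧ : ∀ y z prog α → Π₂ (approximatedᶠ y z prog) α ⇔
      Approximated (read α y) (read α z) (λ j → eval prog α (j ∷ []))
    ⟦approximatedᶠ⟧ y z prog α = mk⇔
      (λ H n → let m = proj₁ (H n) ; tb = π₂ (π₂ m) in
        π₁ m , π₁ (π₂ m) , π₁ tb , π₂ tb ,
        Equivalence.to (⟦approximationᶠ⟧ y z α (eval prog α (π₁ m ∷ [])) (π₁ m) (π₁ (π₂ m)) (π₁ tb) (π₂ tb) n)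
          (proj₂ (H n)))
      (λ A n → let (j , q , t , b , ap) = A n in
        (j ,ℕ q ,ℕ t ,ℕ b) , packed j q t b n (Equivalence.from (⟦approximationᶠ⟧ y z α (eval prog α (j ∷ [])) j q t b n) ap))
      where
      packed : ∀ j q t b n →
        ⟦ approximationᶠ y z ⟧ α (eval prog α (j ∷ []) ∷ j ∷ q ∷ t ∷ b ∷ n ∷ []) →
        ⟦ approximatedᶠ y z prog ⟧ α ((j ,ℕ q ,ℕ t ,ℕ b) ∷ n ∷ [])
      packed j q t b n p
        rewrite π₁-, j (q ,ℕ t ,ℕ b) | π₂-, j (q ,ℕ t ,ℕ b) | π₁-, q (t ,ℕ b) | π₂-, q (t ,ℕ b)
              | π₁-, t b | π₂-, t b = p

-- Finite permutations that carry a given number.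

module Homogeneous (em : ExcludedMiddle 0ℓ) {a : ℕ → ℕ} (a-computable : Computable a)
  (X : ℕ → ℕ) (X-bit : ∀ n → X n ≡ 0 ⊎ X n ≡ 1) where

  open Relativised a-computable

  Far : ℕ → ℕ → ℕ → Set
  Far p b N = ∃[ g ] Injective _≡_ _≡_ g × (∀ v → N ≤ g v) × pull g X p ≡ b

  -- If no injection beyond some N gives 1, then every shift by N + M gives 0, and these shifts lie
  -- beyond any M.
  homogeneous : ∀ p → ∃[ b ] (∀ N → Far p b N)
  homogeneous p with em {∀ N → Far p 0 N}
  ... | yes all = 0 , all
  ... | no ¬all = 1 , far
    where
    far : ∀ N → Far p 1 N
    far N with em {Far p 1 N}
    ... | yes far₁ = far₁
    ... | no ¬far₁ = contradiction far₀ ¬all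
      where
      far₀ : ∀ M → Far p 0 M
      far₀ M with X-bit (pullIndex ((N + M) +_) p)
      ... | inj₁ ≡0 = (N + M) +_ , (λ {u} {v} → +-cancelˡ-≡ (N + M) u v) ,
        (λ v → ≤-trans (m≤n+m M N) (m≤m+n _ v)) , ≡0
      ... | inj₂ ≡1 = contradiction
        ((N + M) +_ , (λ {u} {v} → +-cancelˡ-≡ (N + M) u v) , (λ v → ≤-trans (m≤m+n N M) (m≤m+n _ v)) , ≡1) ¬far₁

  colour : ℕ → ℕ
  colour p = proj₁ (homogeneous p)

  bound : (ℕ → ℕ) → ℕ → ℕ
  bound g zero    = suc (g 0)
  bound g (suc V) = bound g V ⊔ suc (g (suc V))

  <-bound : ∀ g V {v} → v ≤ V → g v < bound g V
  <-bound g zero    z≤n = ≤-refl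
  <-bound g (suc V) v≤ with m≤n⇒m<n∨m≡n v≤
  ... | inj₁ v<  = m≤n⇒m≤n⊔o _ (<-bound g V (s≤s⁻¹ v<))
  ... | inj₂ refl = m≤n⊔m (bound g V) _

  -- Block (j , 0) receives a tuple of the exceptional colour; every other block
  -- receives one of the colour of its pattern, beyond all tuples used before.
  module Arrange (p e : ℕ) (g* : ℕ → ℕ) (g*-injective : Injective _≡_ _≡_ g*)
    (g*-exceptional : pull g* X p ≢ colour p) where

    j : ℕ
    j = p ,ℕ e

    pattern-of : ℕ → ℕ
    pattern-of c = π₁ (π₁ c)

    mutual
      floor : ℕ → ℕ
      floor zero    = bound g* j
      floor (suc c) = floor c ⊔ bound (place c) j

      far : ∀ c → Far (pattern-of c) (colour (pattern-of c)) (floor c)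
      far c = proj₂ (homogeneous (pattern-of c)) (floor c)

      place : ℕ → ℕ → ℕ
      place c = proj₁ (far c)

    floor-mono : ∀ {c d} → c ≤ d → floor c ≤ floor d
    floor-mono {c} {zero}  z≤n = ≤-refl
    floor-mono {c} {suc d} c≤ with m≤n⇒m<n∨m≡n c≤
    ... | inj₁ c<   = m≤n⇒m≤n⊔o _ (floor-mono (s≤s⁻¹ c<))
    ... | inj₂ refl = ≤-refl

    place-floor : ∀ c v → floor c ≤ place c v
    place-floor c = proj₁ (proj₂ (proj₂ (far c)))

    place-< : ∀ {c d u} v → u ≤ j → c < d → place c u < place d v
    place-< {c} {d} v u≤j c<d = ≤-trans (<-bound (place c) j u≤j)
      (≤-trans (m≤n⊔m (floor c) _) (≤-trans (floor-mono c<d) (place-floor d v)))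

    g*-< : ∀ {u} c v → u ≤ j → g* u < place c v
    g*-< c v u≤j = ≤-trans (<-bound g* j u≤j) (≤-trans (floor-mono {0} {c} z≤n) (place-floor c v))

    place-injective : ∀ {c d u v} → u ≤ j → v ≤ j → place c u ≡ place d v → c ≡ d × u ≡ v
    place-injective {c} {d} {u} {v} u≤j v≤j eq with <-cmp c d
    ... | tri< c<d _ _  = contradiction eq (<⇒≢ (place-< v u≤j c<d))
    ... | tri≈ _ refl _ = refl , proj₁ (proj₂ (far c)) eq
    ... | tri> _ _ d<c  = contradiction (sym eq) (<⇒≢ (place-< u v≤j d<c))

    column : ∀ c → Dec (c ≡ (j ,ℕ 0)) → ℕ → ℕ
    column c (yes _) = g*
    column c (no _)  = place c

    column-injective : ∀ {c d u v} c? d? → u ≤ j → v ≤ j →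
      column c c? u ≡ column d d? v → c ≡ d × u ≡ v
    column-injective (yes refl) (yes refl) u≤j v≤j eq = refl , g*-injective eq
    column-injective {d = d} {v = v} (yes _) (no _) u≤j v≤j eq = contradiction eq (<⇒≢ (g*-< d v u≤j))
    column-injective {c} {u = u} (no _) (yes _) u≤j v≤j eq = contradiction (sym eq) (<⇒≢ (g*-< c u v≤j))
    column-injective (no _) (no _) u≤j v≤j eq = place-injective u≤j v≤j eq

    target : ℕ → ℕ
    target n = column (π₁ n) (π₁ n ≟ (j ,ℕ 0)) (π₂ n)

    target-injective : ∀ {m n} → π₂ m ≤ j → π₂ n ≤ j → target m ≡ target n → m ≡ n
    target-injective {m} {n} m≤ n≤ eq
      with column-injective (π₁ m ≟ (j ,ℕ 0)) (π₁ n ≟ (j ,ℕ 0)) m≤ n≤ eq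
    ... | eq₁ , eq₂ = trans (sym (,-π m)) (trans (cong₂ _,ℕ_ eq₁ eq₂) (,-π n))

    arrangement : ∃[ q ] (∀ n → n < suc ((j ,ℕ 1) ,ℕ j) → π₂ n ≤ j → swaps q n ≡ target n)
    -- `target` is injective only where v ≤ j, since the floors clear only that part of each block;
    -- the bound is the largest position that a test up to j reads.
    arrangement = swaps-extend (λ n → π₂ n ≤? j) target target-injective (suc ((j ,ℕ 1) ,ℕ j))

    q : ℕ
    q = proj₁ arrangement

    swaps-q : ∀ {i b v} → i ≤ j → b ≤ 1 → v ≤ j →
      swaps q ((i ,ℕ b) ,ℕ v) ≡ column (i ,ℕ b) ((i ,ℕ b) ≟ (j ,ℕ 0)) v
    swaps-q {i} {b} {v} i≤j b≤1 v≤j = trans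
      (proj₂ arrangement ((i ,ℕ b) ,ℕ v) (s≤s (,ℕ-mono (,ℕ-mono i≤j b≤1) v≤j))
        (subst (_≤ j) (sym (π₂-, (i ,ℕ b) v)) v≤j))
      (cong₂ (λ c v → column c (c ≟ (j ,ℕ 0)) v) (π₁-, (i ,ℕ b) v) (π₂-, (i ,ℕ b) v))

    column-colour : ∀ {i b} → i ≤ j → b ≤ 1 →
      pull ((i ,ℕ b) ,ℕ_) (pull (swaps q) X) (π₁ i)
      ≡ pull (column (i ,ℕ b) ((i ,ℕ b) ≟ (j ,ℕ 0))) X (π₁ i)
    column-colour {i} {b} i≤j b≤1 = cong X (trans (pullIndex-∘ (swaps q) ((i ,ℕ b) ,ℕ_) (π₁ i))
      (pullIndex-cong (π₁ i) λ v v≤ → swaps-q i≤j b≤1 (≤-trans v≤ (≤-trans (π₁≤ i) i≤j))))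

    ordinary : ∀ {i b} → i ≤ j → b ≤ 1 → (i ,ℕ b) ≢ (j ,ℕ 0) →
      pull ((i ,ℕ b) ,ℕ_) (pull (swaps q) X) (π₁ i) ≡ colour (π₁ i)
    ordinary {i} {b} i≤j b≤1 ≢* = trans (column-colour i≤j b≤1) colour-place
      where
      colour-place : pull (column (i ,ℕ b) ((i ,ℕ b) ≟ (j ,ℕ 0))) X (π₁ i) ≡ colour (π₁ i)
      colour-place with (i ,ℕ b) ≟ (j ,ℕ 0)
      ... | yes ≡* = contradiction ≡* ≢*
      ... | no _   = subst (λ r → pull (place (i ,ℕ b)) X r ≡ colour r) (cong π₁ (π₁-, i b))
                       (proj₂ (proj₂ (proj₂ (far (i ,ℕ b)))))

    exceptional : pull ((j ,ℕ 0) ,ℕ_) (pull (swaps q) X) (π₁ j) ≡ pull g* X (π₁ j)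
    exceptional = trans (column-colour ≤-refl z≤n) place-g*
      where
      place-g* : pull (column (j ,ℕ 0) ((j ,ℕ 0) ≟ (j ,ℕ 0))) X (π₁ j) ≡ pull g* X (π₁ j)
      place-g* with (j ,ℕ 0) ≟ (j ,ℕ 0)
      ... | yes _  = refl
      ... | no j≢j = contradiction refl j≢j

    -- Block (j , 0) belongs to test j alone. Every earlier test compares two tuples of the same
    -- colour.
    first : First (pull (swaps q) X) j
    first = tested , untested
      where
      tested : Test (pull (swaps q) X) j
      tested eq = subst (λ r → pull g* X r ≢ colour r) (sym (π₁-, p e)) g*-exceptional
        (trans (sym exceptional) (trans eq (ordinary ≤-refl ≤-refl 1≢0)))
        where
        1≢0 : (j ,ℕ 1) ≢ (j ,ℕ 0)
        1≢0 eq = contradiction (trans (sym (π₂-, j 1)) (trans (cong π₂ eq) (π₂-, j 0))) λ ()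

      untested : ∀ i → i < j → ¬ Test (pull (swaps q) X) i
      untested i i<j T = T (trans (ordinary (<⇒≤ i<j) z≤n (i≢j 0))
                            (sym (ordinary (<⇒≤ i<j) ≤-refl (i≢j 1))))
        where
        i≢j : ∀ b → (i ,ℕ b) ≢ (j ,ℕ 0)
        i≢j b eq = <⇒≢ i<j (trans (sym (π₁-, i b)) (trans (cong π₁ eq) (π₁-, j 0)))

  -- Two different values cannot both be the colour of `p`, so one of the injections is exceptional.
  first-reachable : ∀ {g h p} → Injective _≡_ _≡_ g → Injective _≡_ _≡_ h →
    pull g X p ≢ pull h X p → ∀ e → ∃[ q ] First (pull (swaps q) X) (p ,ℕ e)
  first-reachable {g} {h} {p} g-inj h-inj g≢h e with pull g X p ≟ colour p
  ... | no g≢ = _ , Arrange.first p e g g-inj g≢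
  ... | yes g≡ = _ , Arrange.first p e h h-inj λ h≡ → g≢h (trans g≡ (sym h≡))

least : ExcludedMiddle 0ℓ → ∀ {P : ℕ → Set} n → P n → ∃[ l ] P l × (∀ k → k < l → ¬ P k)
least em {P} zero    p = 0 , p , λ _ ()
least em {P} (suc n) p with em {P 0}
... | yes p₀ = 0 , p₀ , λ _ ()
... | no ¬p₀ with least em {P ∘ suc} n p
...   | l , pl , below = suc l , pl , λ { zero _ → ¬p₀ ; (suc k) (s≤s k<l) → below k k<l }

-- Structures as bit sequences.

symbol-index : ∀ s (R : Symbol s) → symbol s (index R) ≡ just R
symbol-index (finite n) R with index R <? n
... | yes R<n = cong just (fromℕ<-toℕ R R<n)
... | no R≮n  = contradiction (toℕ<n R) R≮n
symbol-index infinite R = refl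

index-symbol : ∀ s i {R} → symbol s i ≡ just R → index R ≡ i
index-symbol (finite n) i eq with i <? n
index-symbol (finite n) i refl | yes i<n = toℕ-fromℕ< i<n
index-symbol infinite i refl = refl

module Structures (L : Language) {a : ℕ → ℕ} (a-computable : Computable a)
  (a-arity : ∀ R → a (index R) ≡ arity L R) where

  open Relativised a-computable

  toCantor-just : ∀ x n {R} → symbol (size L) (π₁ n) ≡ just R →
    toCantor L x n ≡ x R (untuple (arity L R) (π₂ n))
  toCantor-just x n eq rewrite π₁-def n | π₂-def n | eq = refl

  toCantor-nothing : ∀ x n → symbol (size L) (π₁ n) ≡ nothing → toCantor L x n ≡ false
  toCantor-nothing x n eq rewrite π₁-def n | eq = refl

  toCantor-tuple : ∀ x R v → toCantor L x (index R ,ℕ tuple v) ≡ x R v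
  toCantor-tuple x R v = trans
    (toCantor-just x (index R ,ℕ tuple v) (trans (cong (symbol (size L)) (π₁-, (index R) (tuple v))) (symbol-index (size L) R)))
    (cong (x R) (trans (cong (untuple _) (π₂-, (index R) (tuple v))) (untuple-tuple v)))

  pullBack : (ℕ → ℕ) → Structure L → Structure L
  pullBack g x R v = x R (map g v)

  toCantor-pullBack : ∀ g x n → toCantor L (pullBack g x) n ≡ toCantor L x (pullIndex g n)
  toCantor-pullBack g x n with symbol (size L) (π₁ n) in eq
  ... | nothing = trans (toCantor-nothing (pullBack g x) n eq)
    (sym (toCantor-nothing x (pullIndex g n) (trans (cong (symbol (size L)) (π₁-, _ _)) eq)))
  ... | just R = begin
    toCantor L (pullBack g x) n                        ≡⟨ toCantor-just (pullBack g x) n eq ⟩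
    x R (map g (untuple k (π₂ n)))                     ≡⟨ cong (x R) (untuple-mapTuple g k (π₂ n)) ⟨
    x R (untuple k (mapTuple g k (π₂ n)))              ≡⟨ cong (λ l → x R (untuple k (mapTuple g l (π₂ n)))) k≡ ⟨
    x R (untuple k (mapTuple g (a (π₁ n)) (π₂ n)))     ≡⟨ cong (x R ∘ untuple k) (π₂-, (π₁ n) _) ⟨
    x R (untuple k (π₂ (pullIndex g n)))               ≡⟨ toCantor-just x (pullIndex g n) (trans (cong (symbol (size L)) (π₁-, _ _)) eq) ⟨
    toCantor L x (pullIndex g n)                       ∎
    where
    open ≡-Reasoning
    k : ℕ
    k = arity L R
    k≡ : a (π₁ n) ≡ k
    k≡ = trans (cong a (sym (index-symbol (size L) (π₁ n) eq))) (a-arity R)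

  toCantor-cong : ∀ {x y} → SameStructure L x y → ∀ n → toCantor L x n ≡ toCantor L y n
  toCantor-cong {x} {y} x≈y n with symbol (size L) (π₁ n) in eq
  ... | nothing = trans (toCantor-nothing x n eq) (sym (toCantor-nothing y n eq))
  ... | just R  = trans (toCantor-just x n eq) (trans (x≈y R _) (sym (toCantor-just y n eq)))

  toCantor-injective : ∀ {x y} → (∀ n → toCantor L x n ≡ toCantor L y n) → SameStructure L x y
  toCantor-injective {x} {y} eq R v =
    trans (sym (toCantor-tuple x R v)) (trans (eq (index R ,ℕ tuple v)) (toCantor-tuple y R v))

  ≈-sym : ∀ {x y} → SameStructure L x y → SameStructure L y x
  ≈-sym x≈y R v = sym (x≈y R v)

  ≈⇒≅ : ∀ {x y} → SameStructure L x y → ComputablyIsomorphic L x y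
  ≈⇒≅ {y = y} x≈y = id , id-computable , (id , λ n → n , id) ,
    λ R v → trans (x≈y R v) (cong (y R) (sym (map-id v)))

  ≅-sym : ∀ {x y} → ComputablyIsomorphic L x y → ComputablyIsomorphic L y x
  ≅-sym {x} {y} (f , fc , bij@(f-inj , _) , iso) with inverse-computable fc bij
  ... | g , gc , fg = g , gc ,
    ((λ {u} {v} eq → trans (sym (fg u)) (trans (cong f eq) (fg v))) ,
     strictlySurjective⇒surjective λ n → f n , f-inj (fg (f n))) ,
    λ R v → sym (trans (iso R (map g v)) (cong (y R)
      (trans (sym (map-∘ f g v)) (trans (map-cong fg v) (map-id v)))))

  ≅-trans : ∀ {x y z} → ComputablyIsomorphic L x y → ComputablyIsomorphic L y z →
    ComputablyIsomorphic L x z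
  ≅-trans {z = z} (f , fc , f-bij , f-iso) (g , gc , g-bij , g-iso) =
    g ∘ f , Computable-∘ gc fc , ∘-bijective _≡_ _≡_ _≡_ f-bij g-bij ,
    λ R v → trans (f-iso R v) (trans (g-iso R (map f v)) (cong (z R) (sym (map-∘ g f v))))

  bits : Structure L → ℕ → ℕ
  bits x n = bit (toCantor L x n)

  bits-injective : ∀ x y n → bits x n ≡ bits y n → toCantor L x n ≡ toCantor L y n
  bits-injective x y n eq with toCantor L x n | toCantor L y n
  ... | true  | true  = refl
  ... | false | false = refl

  bits-bit : ∀ x n → bits x n ≡ 0 ⊎ bits x n ≡ 1
  bits-bit x n with toCantor L x n
  ... | true  = inj₂ refl
  ... | false = inj₁ refl

  bits-pullBack : ∀ g x n → bits (pullBack g x) n ≡ pull g (bits x) n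
  bits-pullBack g x n = cong bit (toCantor-pullBack g x n)

  bits-cong : ∀ {x y} → SameStructure L x y → ∀ n → bits x n ≡ bits y n
  bits-cong x≈y n = cong bit (toCantor-cong x≈y n)

  bits-≈ : ∀ {x y} → (∀ n → bits x n ≡ bits y n) → SameStructure L x y
  bits-≈ {x} {y} eq = toCantor-injective λ n → bits-injective x y n (eq n)

  opaque
    unfolding _,ℕ_

    ⊕-left : ∀ α β n → (α ⊕ β) (0 ,ℕ n) ≡ α n
    ⊕-left α β n with unpair ⟨ 0 , n ⟩ | unpair-⟨⟩ 0 n
    ... | _ | refl = refl

    ⊕-right : ∀ α β n → (α ⊕ β) (1 ,ℕ n) ≡ β n
    ⊕-right α β n with unpair ⟨ 1 , n ⟩ | unpair-⟨⟩ 1 n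
    ... | _ | refl = refl

  -- A first test (p , c₀ , c₁) carries two programs.
  prog₀ prog₁ : Term 1
  prog₀ = π₁ᵗ (π₂ᵗ #0)
  prog₁ = π₂ᵗ (π₂ᵗ #0)

  Carries : (Y Z : ℕ → ℕ) → Set
  Carries Y Z = Approximated Y Z (λ j → π₁ (π₂ j)) ⊎ Approximated Y Z (λ j → π₂ (π₂ j))

  Carries-≗ : ∀ Y Y′ Z Z′ → (∀ n → Y n ≡ Y′ n) → (∀ n → Z n ≡ Z′ n) → Carries Y Z → Carries Y′ Z′
  Carries-≗ Y Y′ Z Z′ Y≗ Z≗ (inj₁ A) = inj₁ (Approximated-≗ Y Y′ Z Z′ Y≗ Z≗ A)
  Carries-≗ Y Y′ Z Z′ Y≗ Z≗ (inj₂ A) = inj₂ (Approximated-≗ Y Y′ Z Z′ Y≗ Z≗ A)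

  Carries-first : ∀ {Y Z} → Carries Y Z → ∃[ j ] First Z j
  Carries-first (inj₁ A) = approximated-first A
  Carries-first (inj₂ A) = approximated-first A

  approximated⇒≅ : ∀ x y {prog} → Approximated (bits x) (bits y) prog → ComputablyIsomorphic L y x
  approximated⇒≅ x y A = let (f , fc , f-bij , q , eq) = approximated-sound A in
    f ∘ swaps q , Computable-∘ fc (term-computable (swapsᵗ (nat q) #0)) ,
    ∘-bijective _≡_ _≡_ _≡_ (swaps-bijective q) f-bij ,
    bits-≈ {y} {pullBack (f ∘ swaps q) x}
      λ n → trans (eq n) (sym (bits-pullBack (f ∘ swaps q) x n))

  Carries-sound : ∀ x y → Carries (bits x) (bits y) → ComputablyIsomorphic L y x
  Carries-sound x y (inj₁ A) = approximated⇒≅ x y A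
  Carries-sound x y (inj₂ A) = approximated⇒≅ x y A

  -- The graph and its Π⁰₂ definition.

  infixr 3 _orᶠ_

  -- Closure of Π⁰₂ under union: the two universal quantifiers become one over pairs.
  _orᶠ_ : Formula 2 → Formula 2 → Formula 2
  φ orᶠ ψ = (φ at (#0 ∷ π₁ᵗ #1 ∷ [])) ∨ᶠ (ψ at (#0 ∷ π₂ᵗ #1 ∷ []))

  -- Irreflexivity is enforced by a Σ⁰₁ clause, whose witness is absorbed into the existential
  -- witness of `graphᶠ`.
  differᶠ : Formula 2
  differᶠ = ¬ᶠ (askᵗ (nat 0 ,ᵗ #0) ≐ askᵗ (nat 1 ,ᵗ #0))

  carriesᶠ graphᶠ : Formula 2
  carriesᶠ = (approximatedᶠ 0 1 prog₀ orᶠ approximatedᶠ 0 1 prog₁) orᶠ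
             (approximatedᶠ 1 0 prog₀ orᶠ approximatedᶠ 1 0 prog₁)
  graphᶠ   = (differᶠ at (π₁ᵗ #0 ∷ #1 ∷ [])) ∧ᶠ (carriesᶠ at (π₂ᵗ #0 ∷ #1 ∷ []))

  Relation : Formula 2 → Structure L → Structure L → Set
  Relation φ x y = Π₂ φ (toCantor L x ⊕ toCantor L y)

  Relation-Π⁰₂ : ∀ φ → IsΠ⁰₂ L (Relation φ)
  Relation-Π⁰₂ φ =
    (λ n x y → ∃[ m ] ⟦ φ ⟧ (toCantor L x ⊕ toCantor L y) (m ∷ n ∷ [])) ,
    (search φ , λ n x y → mk⇔
      (λ (m , p) → search-halts φ (toCantor L x ⊕ toCantor L y) n m p)
      (λ (m , p) → m , search-sound φ (toCantor L x ⊕ toCantor L y) n m p)) ,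
    λ x y → mk⇔ id id

  opaque
    G : Structure L → Structure L → Set
    G = Relation graphᶠ

    G-Π⁰₂ : IsΠ⁰₂ L G
    G-Π⁰₂ = Relation-Π⁰₂ graphᶠ

  module Graph (em : ExcludedMiddle 0ℓ) where

    Π₂-or : ∀ φ ψ α → Π₂ (φ orᶠ ψ) α ⇔ (Π₂ φ α ⊎ Π₂ ψ α)
    Π₂-or φ ψ α = mk⇔ split join
      where
      join : Π₂ φ α ⊎ Π₂ ψ α → Π₂ (φ orᶠ ψ) α
      join (inj₁ p) n = proj₁ (p (π₁ n)) , inj₁ (proj₂ (p (π₁ n)))
      join (inj₂ p) n = proj₁ (p (π₂ n)) , inj₂ (proj₂ (p (π₂ n)))

      split : Π₂ (φ orᶠ ψ) α → Π₂ φ α ⊎ Π₂ ψ α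
      -- If `φ` fails at n, the instances at all pairs (n , k) leave only `ψ` at k.
      split p with em {∃[ n ] ¬ (∃[ m ] ⟦ φ ⟧ α (m ∷ n ∷ []))}
      ... | no total = inj₁ λ n → decidable-stable em λ ¬φn → total (n , ¬φn)
      ... | yes (n , ¬φn) = inj₂ second
        where
        second : Π₂ ψ α
        second k with p (n ,ℕ k)
        ... | m , inj₁ φm = contradiction
          (m , subst (λ n → ⟦ φ ⟧ α (m ∷ n ∷ [])) (π₁-, n k) φm) ¬φn
        ... | m , inj₂ ψm = m , subst (λ n → ⟦ ψ ⟧ α (m ∷ n ∷ [])) (π₂-, n k) ψm

    module _ (x y : Structure L) where

      private
        α : Cantor
        α = toCantor L x ⊕ toCantor L y

        readˡ : ∀ n → read α 0 n ≡ bits x n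
        readˡ n = cong bit (⊕-left (toCantor L x) (toCantor L y) n)

        readʳ : ∀ n → read α 1 n ≡ bits y n
        readʳ n = cong bit (⊕-right (toCantor L x) (toCantor L y) n)

        carries : ∀ i k → Π₂ (approximatedᶠ i k prog₀ orᶠ approximatedᶠ i k prog₁) α ⇔
          Carries (read α i) (read α k)
        carries i k = mk⇔
          (λ p → Sum.map (to (⟦approximatedᶠ⟧ i k prog₀ α)) (to (⟦approximatedᶠ⟧ i k prog₁ α))
            (to (Π₂-or (approximatedᶠ i k prog₀) (approximatedᶠ i k prog₁) α) p))
          (λ C → from (Π₂-or (approximatedᶠ i k prog₀) (approximatedᶠ i k prog₁) α)
            (Sum.map (from (⟦approximatedᶠ⟧ i k prog₀ α)) (from (⟦approximatedᶠ⟧ i k prog₁ α)) C))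

        either : Π₂ carriesᶠ α ⇔
                 (Π₂ (approximatedᶠ 0 1 prog₀ orᶠ approximatedᶠ 0 1 prog₁) α ⊎
                  Π₂ (approximatedᶠ 1 0 prog₀ orᶠ approximatedᶠ 1 0 prog₁) α)
        either = Π₂-or (approximatedᶠ 0 1 prog₀ orᶠ approximatedᶠ 0 1 prog₁)
          (approximatedᶠ 1 0 prog₀ orᶠ approximatedᶠ 1 0 prog₁) α

      opaque
        unfolding G

        G-sound : G x y → ¬ SameStructure L x y × (Carries (bits x) (bits y) ⊎ Carries (bits y) (bits x))
        G-sound g =
          (λ x≈y → let k = π₁ (proj₁ (g 0)) in
            proj₁ (proj₂ (g 0)) (trans (readˡ k) (trans (bits-cong {x} {y} x≈y k) (sym (readʳ k))))) ,
          Sum.map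
            (λ p → Carries-≗ _ _ _ _ readˡ readʳ (to (carries 0 1) p))
            (λ p → Carries-≗ _ _ _ _ readʳ readˡ (to (carries 1 0) p))
            (to either λ n → π₂ (proj₁ (g n)) , proj₂ (proj₂ (g n)))

        G-complete : ¬ SameStructure L x y → Carries (bits x) (bits y) ⊎ Carries (bits y) (bits x) → G x y
        G-complete x≉y C n with em {∃[ k ] bits x k ≢ bits y k}
        ... | no same = contradiction (bits-≈ λ k → decidable-stable em λ ≢ → same (k , ≢)) x≉y
        ... | yes (k , ≢) = (k ,ℕ proj₁ (carried n)) ,
          (λ eq → ≢ (trans (sym (readˡ k)) (trans
              (subst (λ k → read α 0 k ≡ read α 1 k) (π₁-, k _) eq) (readʳ k)))) ,
          subst (λ m → ⟦ carriesᶠ ⟧ α (m ∷ n ∷ []))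
            (sym (π₂-, k _)) (proj₂ (carried n))
          where
          carried : Π₂ carriesᶠ α
          carried = from either (Sum.map
            (λ p → from (carries 0 1) (Carries-≗ _ _ _ _ (λ n → sym (readˡ n)) (λ n → sym (readʳ n)) p))
            (λ p → from (carries 1 0) (Carries-≗ _ _ _ _ (λ n → sym (readʳ n)) (λ n → sym (readˡ n)) p))
            C)

    -- Paths of length at most 2.

    G-sym : ∀ {x y} → G x y → G y x
    G-sym {x} {y} g with G-sound x y g
    ... | x≉y , C = G-complete y x (x≉y ∘ ≈-sym) (Sum.swap C)

    G⇒≅ : ∀ {x y} → G x y → ComputablyIsomorphic L x y
    G⇒≅ {x} {y} g with G-sound x y g
    ... | _ , inj₁ C = ≅-sym (Carries-sound x y C)
    ... | _ , inj₂ C = Carries-sound y x C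

    bits-iso : ∀ g x y → (∀ R v → x R v ≡ y R (map g v)) → ∀ n → bits x n ≡ pull g (bits y) n
    bits-iso g x y iso n = trans (bits-cong iso n) (bits-pullBack g y n)

    -- As x is y ∘ f, the permutations r for which y ∘ f ∘ r carries j are those for which x ∘ r
    -- does. The least one for x is therefore also the one that y recovers.
    pulledBack-carries : ∀ {x y j q} (prog : ℕ → ℕ) ((f , fc , _) : ComputablyIsomorphic L x y) →
      prog j ≡ encode (proj₁ fc) → First (pull (swaps q) (bits x)) j →
      (∀ r → r < q → ¬ First (pull (swaps r) (bits x)) j) →
      Approximated (bits y) (bits (pullBack (swaps q) x)) prog
    pulledBack-carries {x} {y} {j} {q} prog (f , fc , f-bij , f-iso) prog-j first least =
      approximated-complete {bits y} {bits z} {prog} {f} {j} {q}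
        (subst (λ e → Computes e f) (sym prog-j) (machine-computes fc)) f-bij
        ( First-≗ (pull (swaps q) (bits x)) (bits z) j (λ n → sym (bits-z n)) first
        , First-≗ (pull (swaps q) (bits x)) (pull (f ∘ swaps q) (bits y)) j (bits-xy q) first
        , (λ r r<q F → least r r<q
            (First-≗ (pull (f ∘ swaps r) (bits y)) (pull (swaps r) (bits x)) j (λ n → sym (bits-xy r n)) F))
        , λ n → trans (bits-z n) (bits-xy q n))
      where
      z : Structure L
      z = pullBack (swaps q) x

      bits-z : ∀ n → bits z n ≡ pull (swaps q) (bits x) n
      bits-z = bits-pullBack (swaps q) x

      bits-xy : ∀ r n → pull (swaps r) (bits x) n ≡ pull (f ∘ swaps r) (bits y) n
      bits-xy r n = trans (bits-iso f x y f-iso (pullIndex (swaps r) n))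
        (cong (bits y) (pullIndex-∘ f (swaps r) n))

    -- A bit `p` where x and y differ is a pattern with two values in x, one along the identity and
    -- one along the isomorphism from y to x.
    first-reachable-≅ : ∀ {x y} → ComputablyIsomorphic L x y → ¬ SameStructure L x y →
      ∃[ p ] (∀ e → ∃[ q ] First (pull (swaps q) (bits x)) (p ,ℕ e))
    first-reachable-≅ {x} {y} x≅y x≉y =
      proj₁ differ , Homogeneous.first-reachable em a-computable (bits x) (bits-bit x)
        {id} {proj₁ g} {proj₁ differ} id (proj₁ (proj₁ (proj₂ (proj₂ g))))
        (λ eq → proj₂ differ (trans
          (bits-iso id x x (λ R v → cong (x R) (sym (map-id v))) (proj₁ differ))
          (trans eq (sym (bits-iso (proj₁ g) y x (proj₂ (proj₂ (proj₂ g))) (proj₁ differ))))))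
      where
      g : ComputablyIsomorphic L y x
      g = ≅-sym x≅y

      differ : ∃[ p ] bits x p ≢ bits y p
      differ = decidable-stable em λ none →
        x≉y (bits-≈ λ n → decidable-stable em λ ≢ → none (n , ≢))

    -- A common neighbour: it carries a program for the identity, read by x, and
    -- one for the isomorphism, read by y.
    midpoint : ∀ {x y} → ComputablyIsomorphic L x y → ¬ SameStructure L x y →
      ∃[ z ] Carries (bits x) (bits z) × Carries (bits y) (bits z)
    midpoint {x} {y} x≅y x≉y with first-reachable-≅ x≅y x≉y
    ... | p , reach
      with reach (encode (proj₁ id-computable) ,ℕ encode (proj₁ (proj₁ (proj₂ x≅y))))
    ... | r , F with least em {λ r → First (pull (swaps r) (bits x)) (p ,ℕ encode (proj₁ id-computable) ,ℕ encode (proj₁ (proj₁ (proj₂ x≅y))))} r F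
    ... | q , first , minimal = pullBack (swaps q) x ,
      inj₁ (pulledBack-carries {x} {x} {p ,ℕ c₀ ,ℕ c₁} {q} (λ j → π₁ (π₂ j)) (≈⇒≅ {x} {x} λ R v → refl)
        (trans (cong π₁ (π₂-, p (c₀ ,ℕ c₁))) (π₁-, c₀ c₁)) first minimal) ,
      inj₂ (pulledBack-carries {x} {y} {p ,ℕ c₀ ,ℕ c₁} {q} (λ j → π₂ (π₂ j)) x≅y
        (trans (cong π₂ (π₂-, p (c₀ ,ℕ c₁))) (π₂-, c₀ c₁)) first minimal)
      where
      c₀ c₁ : ℕ
      c₀ = encode (proj₁ id-computable)
      c₁ = encode (proj₁ (proj₁ (proj₂ x≅y)))

    -- The midpoint may equal an endpoint, where irreflexivity forbids an edge; the other edge then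
    -- joins x to y directly.
    path-through : ∀ {x y z} → ¬ SameStructure L x y →
      Carries (bits x) (bits z) → Carries (bits y) (bits z) →
      Dec (SameStructure L x z) → Dec (SameStructure L z y) →
      ∃[ n ] n ≤ 2 × Path (SameStructure L) G n x y
    path-through {x} {y} {z} x≉y Cx Cy (yes x≈z) _ = 1 , s≤s z≤n , step
      (G-complete x y x≉y (inj₂
        (Carries-≗ (bits y) (bits y) (bits z) (bits x) (λ _ → refl) (bits-cong {z} {x} (≈-sym {x} {z} x≈z)) Cy)))
      (stop λ R v → refl)
    path-through {x} {y} {z} x≉y Cx Cy (no x≉z) (yes z≈y) =
      1 , s≤s z≤n , step (G-complete x z x≉z (inj₁ Cx)) (stop z≈y)
    path-through {x} {y} {z} x≉y Cx Cy (no x≉z) (no z≉y) = 2 , ≤-refl ,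
      step (G-complete x z x≉z (inj₁ Cx)) (step (G-complete z y z≉y (inj₂ Cy)) (stop λ R v → refl))

    opaque
      short-path : ∀ x y → ComputablyIsomorphic L x y → ∃[ n ] n ≤ 2 × Path (SameStructure L) G n x y
      short-path x y x≅y = [ (λ x≈y → 0 , z≤n , stop x≈y) , through ]′ (toSum em)
        where
        through : ¬ SameStructure L x y → ∃[ n ] n ≤ 2 × Path (SameStructure L) G n x y
        through x≉y = let (z , Cx , Cy) = midpoint {x} {y} x≅y x≉y in path-through {x} {y} {z} x≉y Cx Cy em em

      path⇒≅ : ∀ {n x y} → Path (SameStructure L) G n x y → ComputablyIsomorphic L x y
      path⇒≅ (stop x≈y)   = ≈⇒≅ x≈y
      path⇒≅ {x = x} {z} (step {y = y} g path) = ≅-trans {x} {y} {z} (G⇒≅ {x} {y} g) (path⇒≅ path)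

    -- A pair at distance 2.

    headIs : ∀ {k} → ℕ → Vec ℕ k → Bool
    headIs A []      = false
    headIs A (u ∷ _) = does (u ≟ A)

    -- Any two of these are isomorphic by a finite permutation, while `A` can be chosen where no
    -- test looks.
    single : ℕ → Structure L
    single A R = headIs A

    headIs-map : ∀ {A B g} → Injective _≡_ _≡_ g → g A ≡ B →
      ∀ {k} (v : Vec ℕ k) → headIs A v ≡ headIs B (map g v)
    headIs-map g-inj gA≡B []      = refl
    headIs-map {A} {B} {g} g-inj gA≡B (u ∷ _) with u ≟ A
    ... | yes refl = trans (dec-true (u ≟ u) refl) (sym (dec-true (g u ≟ B) gA≡B))
    ... | no u≢A   = trans (dec-false (u ≟ A) u≢A)
      (sym (dec-false (g u ≟ B) λ gu≡B → u≢A (g-inj (trans gu≡B (sym gA≡B)))))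

    single-≅ : ∀ A B → ComputablyIsomorphic L (single A) (single B)
    single-≅ A B with swaps-extend {_≡ A} (_≟ A) (λ _ → B) (λ m≡A n≡A _ → trans m≡A (sym n≡A)) (suc A)
    ... | q , agrees = swaps q , term-computable (swapsᵗ (nat q) #0) , swaps-bijective q ,
      λ R v → headIs-map (proj₁ (swaps-bijective q)) (agrees A ≤-refl refl) v

    single-≉ : ∀ {A B} R → 0 < arity L R → A ≢ B → ¬ SameStructure L (single A) (single B)
    single-≉ {A} {B} R 0<k A≢B eq with trans (trans (sym (at-A (arity L R) 0<k)) (eq R (replicate _ A))) (at-B (arity L R))
      where
      at-A : ∀ k → 0 < k → headIs A (replicate k A) ≡ true
      at-A (suc k) _ = dec-true (A ≟ A) refl
      at-B : ∀ k → headIs B (replicate k A) ≡ false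
      at-B zero    = refl
      at-B (suc k) = dec-false (A ≟ B) A≢B
    ... | ()

    headIs-missed : ∀ A g k w → (∀ v → v ≤ w → g v ≢ A) → headIs A (map g (untuple k w)) ≡ false
    headIs-missed A g zero    w missed = refl
    headIs-missed A g (suc k) w missed =
      dec-false (_ ≟ A) (missed _ (subst (_≤ w) (π₁-def w) (π₁≤ w)))

    bits-single-missed : ∀ A g n → (∀ v → v ≤ n → g v ≢ A) → pull g (bits (single A)) n ≡ 0
    bits-single-missed A g n missed = trans (sym (bits-pullBack g (single A) n)) (cong bit missed-n)
      where
      missed-n : toCantor L (pullBack g (single A)) n ≡ false
      missed-n with symbol (size L) (π₁ n) in eq
      ... | nothing = toCantor-nothing (pullBack g (single A)) n eq
      ... | just R  = trans (toCantor-just (pullBack g (single A)) n eq)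
        (headIs-missed A g (arity L R) (π₂ n) λ v v≤ → missed v (≤-trans v≤ (π₂≤ n)))

    -- Block (j , b) only uses the numbers ((j , b) , v) with v ≤ j.
    offBlocks : ℕ → ℕ
    offBlocks k = (0 ,ℕ 0) ,ℕ suc k

    -- Block (0 , 0) is read by test 0 alone and only at v = 0, so the marked point is never seen
    -- and both compared bits are 0.
    single-untested : ∀ k j → ¬ Test (bits (single (offBlocks k))) j
    single-untested k j T = T (trans (zero-on 0) (sym (zero-on 1)))
      where
      zero-on : ∀ b → pull ((j ,ℕ b) ,ℕ_) (bits (single (offBlocks k))) (π₁ j) ≡ 0
      zero-on b = bits-single-missed (offBlocks k) ((j ,ℕ b) ,ℕ_) (π₁ j) λ v v≤ eq →
        contradiction
          (≤-trans (≤-reflexive (v≡ v eq)) (≤-trans v≤ (≤-trans (π₁≤ j) (≤-reflexive (j≡ v eq)))))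
          λ ()
        where
        v≡ : ∀ v → ((j ,ℕ b) ,ℕ v) ≡ offBlocks k → suc k ≡ v
        v≡ v eq = trans (sym (π₂-, _ (suc k))) (trans (cong π₂ (sym eq)) (π₂-, _ v))
        j≡ : ∀ v → ((j ,ℕ b) ,ℕ v) ≡ offBlocks k → j ≡ 0
        j≡ v eq = trans (sym (π₁-, j b)) (trans (cong π₁ (trans (sym (π₁-, _ v)) (trans (cong π₁ eq) (π₁-, _ (suc k))))) (π₁-, 0 0))

    single-isolated : ∀ k l y → SameStructure L y (single (offBlocks l)) → ¬ G (single (offBlocks k)) y
    single-isolated k l y y≈ g with G-sound (single (offBlocks k)) y g
    ... | _ , inj₂ C with Carries-first C
    ...   | j , T , _ = single-untested k j T
    single-isolated k l y y≈ g | _ , inj₁ C with Carries-first C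
    ...   | j , first with First-≗ _ _ j (bits-cong y≈) first
    ...     | T , _ = single-untested l j T

    -- Two marked points off the blocks give isomorphic structures that are distinct and not joined.
    -- This takes a symbol of positive arity: with nullary symbols alone, isomorphism is equality.
    diameter≥2 : ∃[ R ] 0 < arity L R → ∀ l → DiameterAtMost (SameStructure L) G l → 2 ≤ l
    diameter≥2 (R , 0<k) l d = long
      (d (single (offBlocks 0)) (single (offBlocks 1))
        (let (n , _ , path) = short-path _ _ (single-≅ (offBlocks 0) (offBlocks 1)) in n , path))
      where
      distinct : offBlocks 0 ≢ offBlocks 1
      distinct eq = contradiction (trans (sym (π₂-, (0 ,ℕ 0) 1)) (trans (cong π₂ eq) (π₂-, (0 ,ℕ 0) 2))) λ ()

      long : ∃[ n ] n ≤ l × Path (SameStructure L) G n (single (offBlocks 0)) (single (offBlocks 1)) → 2 ≤ l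
      long (0 , _ , stop eq)               = contradiction eq (single-≉ R 0<k distinct)
      long (1 , _ , step g (stop y≈))      = contradiction g (single-isolated 0 1 _ y≈)
      long (suc (suc n) , n≤l , _)         = ≤-trans (s≤s (s≤s z≤n)) n≤l

    G-simple : IsSimpleGraph (SameStructure L) G
    G-simple = (λ {x} {y} x≈y g → proj₁ (G-sound x y g) x≈y) , λ {x} {y} → G-sym {x} {y}

    ≅⇔connected : ∀ x y → ComputablyIsomorphic L x y ⇔ Connected (SameStructure L) G x y
    ≅⇔connected x y = mk⇔
      (λ x≅y → let (n , _ , path) = short-path x y x≅y in n , path)
      (λ (_ , path) → path⇒≅ {x = x} {y} path)

    diameter≤2 : DiameterAtMost (SameStructure L) G 2
    diameter≤2 x y (_ , path) = short-path x y (path⇒≅ {x = x} {y} path)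

    graphable : ∃[ R ] 0 < arity L R → Π⁰₂-GraphableWithDiameter L (ComputablyIsomorphic L) 2
    graphable nontrivial = G , G-simple , G-Π⁰₂ , ≅⇔connected , diameter≤2 , diameter≥2 nontrivial

theorem6p3 : ExcludedMiddle 0ℓ →
    (L : Language) → ComputableLanguage L → (∃[ R ] 0 < arity L R) →
    Π⁰₂-GraphableWithDiameter L (ComputablyIsomorphic L) 2
theorem6p3 em L (a , a-computable , a-arity) =
  Structures.Graph.graphable L a-computable a-arity em
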